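{- Let $G$ be a (possibly infinite) graph and $\mathcal{P}$ a set of robust regular profiles in $G$, any two of which are distinguishable. Then there exists a set $\mathcal{N}$ of finite vertex sets of $G$ which is nested (for all $X,Y\in\mathcal{N}$ there is a component $C$ of $G-Y$ with $X\subseteq C\cup Y$) and such that for any two distinct $P,P'\in\mathcal{P}$ some $X\in\mathcal{N}$ efficiently distinguishes $P$ and $P'$. Moreover $\mathcal{N}$ can be chosen canonically, i.e. invariant under isomorphisms: if $\phi\colon G\to G'$ is a graph isomorphism then $\mathcal{N}(G',\phi(\mathcal{P}))=\phi(\mathcal{N}(G,\mathcal{P}))$.
   Context: A separation of a graph $G=(V,E)$ is a pair $(A,B)$ with $A\cup B=V$ and no edge between $A\smallsetminus B$ and $B\smallsetminus A$; its separator is $A\cap B$ and its order is $|A\cap B|$ (when finite). Its inverse is $(B,A)$; the unoriented separation is $\{A,B\}$. Partial order: $(A,B)\le(C,D)$ iff $A\subseteq C$ and $B\supseteq D$. Join $(A,B)\lor(C,D)=(A\cup C,B\cap D)$, meet $(A,B)\land(C,D)=(A\cap C,B\cup D)$. For $k\in\mathbb{N}\cup\{\aleph_0\}$, $S_k$ is the set of separations of order $<k$. A $k$-profile (a profile in $G$) is a set $P$ of separations of order $<k$ containing exactly one of $(A,B),(B,A)$ for each separation of order $<k$, which is consistent (there are no $(A,B),(C,D)\in P$ with $\{A,B\}\neq\{C,D\}$ and $(B,A)\le(C,D)$) and satisfies: for all $(A,B),(C,D)\in P$, $(B\cap D,A\cup C)\notin P$. $P$ is robust if for all $(A,B)\in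 P$ and every separation $(C,D)$ of finite order: if $|(A,B)\lor(C,D)|<|A\cap B|$ and $|(A,B)\lor(D,C)|<|A\cap B|$ then $(A,B)\lor(C,D)\in P$ or $(A,B)\lor(D,C)\in P$. $P$ is regular if it contains no separation of the form $(V,X)$. A separation $\{A,B\}$ distinguishes profiles $P,P'$ if $(A,B)\in P$ and $(B,A)\in P'$ or vice versa; it does so efficiently if its order is minimal among all separations distinguishing $P,P'$; profiles are distinguishable if some separation distinguishes them. A vertex set $X$ efficiently distinguishes $P,P'$ if some separation with separator $X$ efficiently distinguishes them. -}

module Defs where

open import Level using (Level; 0ℓ) renaming (suc to lsuc)
open import Data.Nat using (ℕ; _<_; _≤_)
open import Data.List using (List; length)
open import Data.List.Relation.Unary.Unique.Propositional using (Unique)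
open import Data.List.Membership.Propositional using (_∈_)
open import Data.Product using (Σ; ∃; ∃-syntax; _×_; _,_; proj₁; proj₂)
open import Data.Sum using (_⊎_)
open import Data.Empty using (⊥)
open import Relation.Nullary using (¬_)
open import Relation.Binary.PropositionalEquality using (_≡_; _≢_)
open import Axiom.ExcludedMiddle using (ExcludedMiddle)

record Graph : Set₁ where
  field
    V        : Set
    E        : V → V → Set
    E-sym    : ∀ {u v} → E u v → E v u
    E-irrefl : ∀ {v} → ¬ E v v

VSet : Graph → Set₁
VSet G = Graph.V G → Set

Sep : Graph → Set₁
Sep G = VSet G × VSet G

SepPred : Graph → Set₁
SepPred G = Sep G → Set

VFam : Graph → Set₁
VFam G = VSet G → Set

data Card : Set where
  fin : ℕ → Card
  ℵ₀  : Card


module _ (G : Graph) where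
  open Graph G

  inv : Sep G → Sep G
  inv (A , B) = (B , A)

  _⊆_ : VSet G → VSet G → Set
  X ⊆ Y = ∀ v → X v → Y v

  _≐_ : VSet G → VSet G → Set
  X ≐ Y = (X ⊆ Y) × (Y ⊆ X)

  _∩_ : VSet G → VSet G → VSet G
  (X ∩ Y) v = X v × Y v

  _∪_ : VSet G → VSet G → VSet G
  (X ∪ Y) v = X v ⊎ Y v

  Full : VSet G
  Full v = Data.Unit.⊤
    where import Data.Unit

  HasSize : VSet G → ℕ → Set
  HasSize X n = Σ (List V) λ xs →
    (length xs ≡ n) × Unique xs × (∀ v → (X v → v ∈ xs) × (v ∈ xs → X v))

  Finite : VSet G → Set
  Finite X = ∃[ n ] HasSize X n

  IsSeparation : Sep G → Set
  IsSeparation (A , B) =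
    (∀ v → A v ⊎ B v) ×
    (∀ u v → A u → ¬ B u → B v → ¬ A v → ¬ E u v)

  separator : Sep G → VSet G
  separator (A , B) = A ∩ B

  HasOrder : Sep G → ℕ → Set
  HasOrder s n = HasSize (separator s) n

  FiniteOrder : Sep G → Set
  FiniteOrder s = Finite (separator s)

  OrderBelow : Sep G → Card → Set
  OrderBelow s (fin k) = ∃[ n ] (HasOrder s n × n < k)
  OrderBelow s ℵ₀      = FiniteOrder s

  S : Card → Sep G → Set
  S k s = IsSeparation s × OrderBelow s k

  _≤s_ : Sep G → Sep G → Set
  (A , B) ≤s (C , D) = (A ⊆ C) × (D ⊆ B)

  join : Sep G → Sep G → Sep G
  join (A , B) (C , D) = (A ∪ C , B ∩ D)

  meet : Sep G → Sep G → Sep G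
  meet (A , B) (C , D) = (A ∩ C , B ∪ D)

  SepEq : Sep G → Sep G → Set
  SepEq (A , B) (C , D) = (A ≐ C) × (B ≐ D)

  SameUnoriented : Sep G → Sep G → Set
  SameUnoriented s t = SepEq s t ⊎ SepEq s (inv t)

  -- sets of separations are taken up to extensional equality
  Respects : SepPred G → Set₁
  Respects P = ∀ s t → SepEq s t → P s → P t

  IsKProfile : Card → SepPred G → Set₁
  IsKProfile k P =
    Respects P ×
    (∀ s → P s → S k s) ×
    (∀ s → S k s → P s ⊎ P (inv s)) ×
    (∀ s → S k s → ¬ (P s × P (inv s))) ×
    (∀ s t → P s → P t → ¬ SameUnoriented s t → ¬ (inv s ≤s t)) ×
    (∀ s t → P s → P t → ¬ P (proj₂ s ∩ proj₂ t , proj₁ s ∪ proj₁ t))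

  IsProfile : SepPred G → Set₁
  IsProfile P = ∃[ k ] IsKProfile k P

  Robust : SepPred G → Set₁
  Robust P = ∀ A B → P (A , B) → ∀ C D → IsSeparation (C , D) → FiniteOrder (C , D) →
    ∀ n m₁ m₂ → HasOrder (A , B) n →
    HasOrder (join (A , B) (C , D)) m₁ → m₁ < n →
    HasOrder (join (A , B) (D , C)) m₂ → m₂ < n →
    P (join (A , B) (C , D)) ⊎ P (join (A , B) (D , C))

  Regular : SepPred G → Set₁
  Regular P = ∀ X → ¬ P (Full , X)

  Distinguishes : Sep G → SepPred G → SepPred G → Set
  Distinguishes s P Q = IsSeparation s × ((P s × Q (inv s)) ⊎ (P (inv s) × Q s))

  EffDistinguishes : Sep G → SepPred G → SepPred G → Set₁
  EffDistinguishes s P Q = Distinguishes s P Q ×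
    ∃[ n ] (HasOrder s n × (∀ t m → Distinguishes t P Q → HasOrder t m → n ≤ m))

  Distinguishable : SepPred G → SepPred G → Set₁
  Distinguishable P Q = ∃[ s ] Distinguishes s P Q

  SetEffDistinguishes : VSet G → SepPred G → SepPred G → Set₁
  SetEffDistinguishes X P Q = ∃[ s ] (separator s ≐ X × EffDistinguishes s P Q)

  data Reach (Y : VSet G) : V → V → Set where
    here : ∀ {v} → ¬ Y v → Reach Y v v
    step : ∀ {u v w} → Reach Y u v → E v w → ¬ Y w → Reach Y u w

  IsComponent : VSet G → VSet G → Set
  IsComponent Y C = ∃[ c ] (¬ Y c × (∀ v → (C v → Reach Y c v) × (Reach Y c v → C v)))

  Nested : VFam G → Set₁
  Nested 𝒩 = ∀ X Y → 𝒩 X → 𝒩 Y → ∃[ C ] (IsComponent Y C × X ⊆ (C ∪ Y))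

  ProfEq : SepPred G → SepPred G → Set₁
  ProfEq P Q = ∀ s → (P s → Q s) × (Q s → P s)

  SameProfileSets : (I : Set) → (I → SepPred G) → (J : Set) → (J → SepPred G) → Set₁
  SameProfileSets I Ps J Qs =
    (∀ i → ∃[ j ] ProfEq (Ps i) (Qs j)) × (∀ j → ∃[ i ] ProfEq (Ps i) (Qs j))

  SameVFams : VFam G → VFam G → Set₁
  SameVFams 𝒜 ℬ = (∀ X → 𝒜 X → ∃[ Y ] (ℬ Y × X ≐ Y)) × (∀ Y → ℬ Y → ∃[ X ] (𝒜 X × X ≐ Y))

  GoodProfileSet : (I : Set) → (I → SepPred G) → Set₁
  GoodProfileSet I Ps =
    (∀ i → IsProfile (Ps i) × Robust (Ps i) × Regular (Ps i)) ×
    (∀ i j → i ≢ j → Distinguishable (Ps i) (Ps j))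

record Iso (G G' : Graph) : Set where
  open Graph G
  open Graph G' renaming (V to V'; E to E')
  field
    f   : V → V'
    g   : V' → V
    fg  : ∀ v' → f (g v') ≡ v'
    gf  : ∀ v → g (f v) ≡ v
    hom : ∀ u v → (E u v → E' (f u) (f v)) × (E' (f u) (f v) → E u v)

module _ {G G' : Graph} (φ : Iso G G') where
  open Iso φ

  pushV : VSet G → VSet G'
  pushV X v' = X (g v')

  pullV : VSet G' → VSet G
  pullV X' v = X' (f v)

  pushProfile : SepPred G → SepPred G'
  pushProfile P (A' , B') = P (pullV A' , pullV B')

  IsImageFam : VFam G → VFam G' → Set₁
  IsImageFam 𝒩 𝒩' =
    (∀ X → 𝒩 X → ∃[ Y ] (𝒩' Y × _≐_ G' Y (pushV X))) ×
    (∀ Y → 𝒩' Y → ∃[ X ] (𝒩 X × _≐_ G' Y (pushV X)))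

{-# OPTIONS --safe #-}
module Submission where

-- For a finite separator X call a component of G − X full if its neighbourhood is all of X.  By
-- regularity, an efficient distinguisher of two profiles has a full component on either side, and
-- two such separators X, Y are nested as soon as Y misses some full component of X; this is
-- symmetric, and any Z nested with two crossing X, Y is nested with every subset of X ∪ Y, in
-- particular with the separators of their corners.  By Halin's path argument X crosses only
-- finitely many separators of a given size.  The set N is chosen by recursion on the order k: for
-- each pair of profiles take those efficient separators of order k which are nested with everything
-- chosen before and which cross as few separators of order k as possible.  Robustness yields a
-- corner that uncrosses a separator from one of lower order, so such separators exist; at equal
-- orders two opposite corners together cross fewer separators than X and Y do, so no two chosen
-- separators of order k cross.

open import Defs
open import Level using (0ℓ; _⊔_) renaming (suc to lsuc)
open import Data.Nat using (ℕ; zero; suc; _+_; _≤_; _<_; z≤n; s≤s)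
open import Data.Nat.Properties
open import Data.List using (List; []; _∷_; _++_; length; map; filter; deduplicate; concat; cartesianProductWith)
open import Data.List.Properties using (length-++; length-filter; length-deduplicate; length-map; filter-notAll)
open import Data.List.Membership.Propositional using (_∈_; find; lose)
open import Data.List.Membership.Propositional.Properties using (∈-filter⁺; ∈-filter⁻; ∈-deduplicate⁺; ∈-deduplicate⁻; ∈-map⁺; ∈-map⁻; ∈-cartesianProductWith⁺)
open import Data.List.Relation.Unary.Any as Any using (Any; here; there)
import Data.List.Relation.Unary.Any.Properties as Anyₚ
import Data.List.Relation.Unary.Unique.DecPropositional.Properties as DecUnique
import Data.List.Relation.Unary.Unique.Propositional.Properties as Uniqueₚ
open import Data.Product using (Σ; Σ-syntax; ∃; ∃-syntax; _×_; _,_; proj₁; proj₂; swap)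
open import Data.Sum using (_⊎_; inj₁; inj₂; [_,_]′)
open import Data.Empty using (⊥; ⊥-elim)
open import Data.Empty.Polymorphic using () renaming (⊥ to ⊥ₚ)
open import Function using (_∘_; id)
open import Relation.Nullary using (¬_; Dec; yes; no; contradiction)
open import Relation.Nullary.Decidable using (True; toWitness; fromWitness; decidable-stable)
open import Relation.Unary using (Decidable)
open import Relation.Binary using (tri<; tri≈; tri>)
open import Relation.Binary.PropositionalEquality using (_≡_; _≢_; refl; sym; trans; cong; subst; subst₂)
open import Axiom.ExcludedMiddle using (ExcludedMiddle)

-- Counting with covering lists.

+-<-split : ∀ {a b n m} → a + b < n + m → a < n ⊎ b < m
+-<-split {a} {b} {n} {m} lt with a <? n | b <? m
... | yes p | _ = inj₁ p
... | no _ | yes q = inj₂ q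
... | no p | no q = contradiction (+-mono-≤ (≮⇒≥ p) (≮⇒≥ q)) (<⇒≱ lt)

least : ∀ {p} → ExcludedMiddle p → (P : ℕ → Set p) → ∀ n → P n →
  ∃[ m ] (P m × (∀ l → P l → m ≤ l))
least em P zero p = zero , p , λ _ _ → z≤n
least em P (suc n) p with em {P zero}
... | yes p₀ = zero , p₀ , λ _ _ → z≤n
... | no ¬p₀ with least em (P ∘ suc) n p
... | m , pm , min = suc m , pm , λ
  { zero p₀ → contradiction p₀ ¬p₀ ; (suc l) pl → s≤s (min l pl) }

module _ {a p} {A : Set a} {P Q : A → Set p} (P? : Decidable P) (Q? : Decidable Q)
  (disjoint : ∀ z → P z → ¬ Q z) where

  length-filter-disjoint : ∀ xs → length (filter P? xs) + length (filter Q? xs) ≤ length xs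
  length-filter-disjoint [] = z≤n
  length-filter-disjoint (x ∷ xs) with ih ← length-filter-disjoint xs | P? x | Q? x
  ... | yes px | yes qx = contradiction qx (disjoint x px)
  ... | yes _  | no _   = s≤s ih
  ... | no _   | yes _  = ≤-trans (≤-reflexive (+-suc _ _)) (s≤s ih)
  ... | no _   | no _   = m≤n⇒m≤1+n ih

  length-filter-disjoint-< : ∀ {xs} → Any (λ z → ¬ P z × ¬ Q z) xs →
    length (filter P? xs) + length (filter Q? xs) < length xs
  length-filter-disjoint-< {x ∷ xs} (here (¬p , ¬q)) with P? x | Q? x
  ... | yes px | _      = contradiction px ¬p
  ... | no _   | yes qx = contradiction qx ¬q
  ... | no _   | no _   = s≤s (length-filter-disjoint xs)
  length-filter-disjoint-< {x ∷ xs} (there any)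
    with ih ← length-filter-disjoint-< any | P? x | Q? x
  ... | yes px | yes qx = contradiction qx (disjoint x px)
  ... | yes _  | no _   = s≤s ih
  ... | no _   | yes _  = ≤-trans (≤-reflexive (cong suc (+-suc _ _))) (s≤s ih)
  ... | no _   | no _   = m≤n⇒m≤1+n ih

any-filter : ∀ {a p q} {A : Set a} {P : A → Set p} {Q : A → Set q} (P? : Decidable P) {xs} →
  Any (λ z → Q z × P z) xs → Any Q (filter P? xs)
any-filter P? any with find any
... | z , z∈ , q , p = lose (∈-filter⁺ P? z∈ p) q

-- Bounding cardinalities from above by covering lists avoids both quotients and the
-- well-definedness of cardinality.
Covers : ∀ {a p} {A : Set a} (_≈_ : A → A → Set) (P : A → Set p) → ℕ → Set (a ⊔ p)
Covers {A = A} _≈_ P n = Σ[ xs ∈ List A ] (length xs ≤ n × (∀ z → P z → Any (z ≈_) xs))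

covers-mono : ∀ {a p q} {A : Set a} {_≈_ : A → A → Set} {P : A → Set p} {Q : A → Set q} {n m} →
  (∀ z → Q z → P z) → n ≤ m → Covers _≈_ P n → Covers _≈_ Q m
covers-mono sub n≤m (xs , len , cov) = xs , ≤-trans len n≤m , λ z → cov z ∘ sub z

module _ {a p} (em : ExcludedMiddle p) {A : Set a} (_≈_ : A → A → Set)
  (≈-sym : ∀ {x y} → x ≈ y → y ≈ x) where

  -- Each entry of `xs` and of `ys` is used for at most one of the two new covers: an element of
  -- both `W` and `W′` lies in `X` and in `Y`, so `ws` can count it by an entry of `xs` and `ws′` by
  -- an entry of `ys`. An entry of `xs` outside `W` and `W′` is used for neither, which makes the
  -- bound strict. Applied to vertices this gives submodularity of the order, applied to separators
  -- that of the crossing number.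
  covers-submodular : (X Y W W′ : A → Set p) →
    (∀ {z z′} → z ≈ z′ → X z → X z′) → (∀ {z z′} → z ≈ z′ → Y z → Y z′) →
    (∀ {z z′} → z ≈ z′ → W z → W z′) → (∀ {z z′} → z ≈ z′ → W′ z → W′ z′) →
    (∀ z → W z → X z ⊎ Y z) → (∀ z → W′ z → X z ⊎ Y z) →
    (∀ z → W z → W′ z → X z × Y z) →
    ∀ {n m} → Covers _≈_ X n → Covers _≈_ Y m →
    ∃[ a ] ∃[ b ] (Covers _≈_ W a × Covers _≈_ W′ b × a + b ≤ n + m ×
      (∀ z → X z → ¬ W z → ¬ W′ z → a + b < n + m))
  covers-submodular X Y W W′ resX resY resW resW′ W⊆ W′⊆ both {n} {m}
    (xs , lenx , covx) (ys , leny , covy) =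
    length ws , length ws′ , (ws , ≤-refl , covw) , (ws′ , ≤-refl , covw′) , bound , strict
    where
    only : (A → Set p) → (A → Set p) → A → Set p
    only R S z = R z × ¬ S z
    D : (R : A → Set p) → Decidable R
    D R z = em
    ws = filter (D W) xs ++ filter (D (only W X)) ys
    ws′ = filter (D (only W′ Y)) xs ++ filter (D W′) ys
    dx : ∀ z → W z → ¬ only W′ Y z
    dx z w (w′ , ¬y) = ¬y (proj₂ (both z w w′))
    dy : ∀ z → only W X z → ¬ W′ z
    dy z (w , ¬x) w′ = ¬x (proj₁ (both z w w′))
    covw : ∀ z → W z → Any (z ≈_) ws
    covw z w with em {X z} | W⊆ z w
    ... | yes x | _ = Anyₚ.++⁺ˡ (any-filter (D W) (Any.map (λ e → e , resW e w) (covx z x)))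
    ... | no ¬x | inj₁ x = contradiction x ¬x
    ... | no ¬x | inj₂ y = Anyₚ.++⁺ʳ (filter (D W) xs) (any-filter (D (only W X))
      (Any.map (λ e → e , resW e w , ¬x ∘ resX (≈-sym e)) (covy z y)))
    covw′ : ∀ z → W′ z → Any (z ≈_) ws′
    covw′ z w with em {Y z} | W′⊆ z w
    ... | yes y | _ = Anyₚ.++⁺ʳ (filter (D (only W′ Y)) xs)
      (any-filter (D W′) (Any.map (λ e → e , resW′ e w) (covy z y)))
    ... | no ¬y | inj₂ y = contradiction y ¬y
    ... | no ¬y | inj₁ x = Anyₚ.++⁺ˡ (any-filter (D (only W′ Y))
      (Any.map (λ e → e , resW′ e w , ¬y ∘ resY (≈-sym e)) (covx z x)))
    a₁ = length (filter (D W) xs)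
    a₂ = length (filter (D (only W X)) ys)
    b₁ = length (filter (D (only W′ Y)) xs)
    b₂ = length (filter (D W′) ys)
    total : length ws + length ws′ ≡ (a₁ + b₁) + (a₂ + b₂)
    total = begin
      length ws + length ws′     ≡⟨ cong (_+ length ws′) (length-++ (filter (D W) xs)) ⟩
      (a₁ + a₂) + length ws′     ≡⟨ cong ((a₁ + a₂) +_) (length-++ (filter (D (only W′ Y)) xs)) ⟩
      (a₁ + a₂) + (b₁ + b₂)      ≡⟨ interchange a₁ a₂ b₁ b₂ ⟩
      (a₁ + b₁) + (a₂ + b₂)      ∎
      where
      open Relation.Binary.PropositionalEquality.≡-Reasoning
      open import Algebra.Properties.CommutativeSemigroup +-commutativeSemigroup using (interchange)
    bound : length ws + length ws′ ≤ n + m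
    bound = ≤-trans (≤-reflexive total) (+-mono-≤
      (≤-trans (length-filter-disjoint (D W) (D (only W′ Y)) dx xs) lenx)
      (≤-trans (length-filter-disjoint (D (only W X)) (D W′) dy ys) leny))
    strict : ∀ z → X z → ¬ W z → ¬ W′ z → length ws + length ws′ < n + m
    strict z x ¬w ¬w′ = ≤-trans (s≤s (≤-reflexive total)) (+-mono-≤
      (≤-trans (length-filter-disjoint-< (D W) (D (only W′ Y)) dx
        (Any.map (λ e → ¬w ∘ resW (≈-sym e) , ¬w′ ∘ resW′ (≈-sym e) ∘ proj₁) (covx z x))) lenx)
      (≤-trans (length-filter-disjoint (D (only W X)) (D W′) dy ys) leny))

  covers-remove : ∀ {P Q : A → Set p} {n} → (∀ {z z′} → z ≈ z′ → Q z → Q z′) →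
    (∀ z → Q z → P z) → ∀ z → P z → ¬ Q z →
    Covers _≈_ P n → ∃[ m ] (m < n × Covers _≈_ Q m)
  covers-remove {Q = Q} resQ sub z p ¬q (xs , len , cov) =
    _ , ≤-trans (filter-notAll Q? xs (Any.map (λ e → ¬q ∘ resQ (≈-sym e)) (cov z p))) len ,
    filter Q? xs , ≤-refl ,
    λ z′ q → any-filter Q? (Any.map (λ e → e , resQ e q) (cov z′ (sub z′ q)))
    where
    Q? : Decidable Q
    Q? z = em

-- Full components, crossing numbers and the recursive choice.

module Notions (G : Graph) where
  open Graph G

  -- The vertex `d` stands for its component of G - X.
  Full⟨_⟩ : VSet G → V → Set
  Full⟨ X ⟩ d = ¬ X d × (∀ x → X x → ∃[ v ] (Reach G X d v × E v x))

  -- Nestedness of separators, phrased through a component of G − X whose neighbourhood is all of X.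
  _Misses_ : VSet G → VSet G → Set
  X Misses Y = ∃[ d ] (Full⟨ X ⟩ d × (∀ v → Reach G X d v → ¬ Y v))

  Tight : VSet G → Set
  Tight X = ∃[ d ] ∃[ e ] (Full⟨ X ⟩ d × Full⟨ X ⟩ e × ¬ Reach G X d e)

  -- Unlike `EffDistinguishes`, this fixes which of the two profiles contains `s` and exposes the
  -- order, so that corners can be oriented.
  record Eff (P Q : SepPred G) (k : ℕ) (s : Sep G) : Set₁ where
    field
      isSep   : IsSeparation G s
      inP     : P s
      inQ     : Q (inv G s)
      order   : HasOrder G s k
      minimal : ∀ t m → Distinguishes G t P Q → HasOrder G t m → k ≤ m

  EffSeparator : SepPred G → SepPred G → ℕ → VSet G → Set₁
  EffSeparator P Q k X = ∃[ s ] (_≐_ G (separator G s) X × Eff P Q k s)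

  CrossingNumber≤ : (VSet G → Set₁) → VSet G → ℕ → Set₁
  CrossingNumber≤ T X = Covers (_≐_ G) (λ Z → T Z × ¬ Z Misses X)

  module Choice {I : Set} (Ps : I → SepPred G) where

    OfOrder : ℕ → VSet G → Set₁
    OfOrder k X = ∃[ i ] ∃[ j ] EffSeparator (Ps i) (Ps j) k X

    Candidate : (VSet G → Set₁) → I → I → ℕ → VSet G → Set₁
    Candidate F i j k X = EffSeparator (Ps i) (Ps j) k X × (∀ Z → F Z → Z Misses X)

    -- Minimality is expressed by upper bounds: each bound on the crossing number of a competitor
    -- for the same `i` and `j` also bounds that of `X`. All minimisers are taken, since picking one
    -- of them would not be canonical.
    Selected : (VSet G → Set₁) → ℕ → VSet G → Set₁
    Selected F k X = ∃[ i ] ∃[ j ] (Candidate F i j k X ×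
      (∀ Y → Candidate F i j k Y → ∀ n →
        CrossingNumber≤ (OfOrder k) Y n → CrossingNumber≤ (OfOrder k) X n))

    ChosenBelow : ℕ → VSet G → Set₁
    ChosenBelow zero    X = ⊥ₚ
    ChosenBelow (suc k) X = ChosenBelow k X ⊎ Selected (ChosenBelow k) k X

    Chosen : VSet G → Set₁
    Chosen X = ∃[ k ] ChosenBelow k X

-- Finite vertex sets, reachability and nestedness of separators.

module Separators (em : ExcludedMiddle 0ℓ) (G : Graph) where
  open Graph G
  open Notions G

  stable : {P : Set} → ¬ ¬ P → P
  stable = decidable-stable em

  hasSize-cong : ∀ {X Y n} → _≐_ G X Y → HasSize G X n → HasSize G Y n
  hasSize-cong (xy , yx) (xs , len , uniq , mem) =
    xs , len , uniq , λ v → proj₁ (mem v) ∘ yx v , xy v ∘ proj₂ (mem v)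

  hasSize⇒covers : ∀ {X n} → HasSize G X n → Covers _≡_ X n
  hasSize⇒covers (xs , len , _ , mem) = xs , ≤-reflexive len , λ v → proj₁ (mem v)

  -- The way back from bounds to exact sizes: filtering discards the entries outside `X`,
  -- deduplication the repetitions.
  covers⇒hasSize : ∀ {X n} → Covers _≡_ X n → ∃[ m ] (HasSize G X m × m ≤ n)
  covers⇒hasSize {X} (xs , len , cov) =
    _ , (ys , refl , DecUnique.deduplicate-! _≟ⱽ_ _ , λ v → to v , from v) ,
    ≤-trans (length-deduplicate _≟ⱽ_ (filter X? xs)) (≤-trans (length-filter X? xs) len)
    where
    X? : Decidable X
    X? v = em
    _≟ⱽ_ : (u v : V) → Dec (u ≡ v)
    u ≟ⱽ v = em
    ys = deduplicate _≟ⱽ_ (filter X? xs)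
    to : ∀ v → X v → v ∈ ys
    to v x = ∈-deduplicate⁺ _≟ⱽ_ (∈-filter⁺ X? (cov v x) x)
    from : ∀ v → v ∈ ys → X v
    from v v∈ = proj₂ (∈-filter⁻ X? {xs = xs} (∈-deduplicate⁻ _≟ⱽ_ (filter X? xs) v∈))

  hasSize-⊆ : ∀ {X Y n} → _⊆_ G X Y → HasSize G Y n → ∃[ m ] (HasSize G X m × m ≤ n)
  hasSize-⊆ sub size = covers⇒hasSize (covers-mono sub ≤-refl (hasSize⇒covers size))

  reach-end : ∀ {Y u v} → Reach G Y u v → ¬ Y v
  reach-end (here ¬y) = ¬y
  reach-end (step _ _ ¬y) = ¬y

  reach-start : ∀ {Y u v} → Reach G Y u v → ¬ Y u
  reach-start (here ¬y) = ¬y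
  reach-start (step r _ _) = reach-start r

  reach-trans : ∀ {Y u v w} → Reach G Y u v → Reach G Y v w → Reach G Y u w
  reach-trans r (here _) = r
  reach-trans r (step q e ¬y) = step (reach-trans r q) e ¬y

  reach-sym : ∀ {Y u v} → Reach G Y u v → Reach G Y v u
  reach-sym (here ¬y) = here ¬y
  reach-sym (step r e ¬y) =
    reach-trans (step (here ¬y) (E-sym e) (reach-end r)) (reach-sym r)

  reach-avoiding : ∀ {Y Z d v} → (∀ u → Reach G Y d u → ¬ Z u) → Reach G Y d v → Reach G Z d v
  reach-avoiding avoid (here ¬y) = here (avoid _ (here ¬y))
  reach-avoiding avoid (step r e ¬y) = step (reach-avoiding avoid r) e (avoid _ (step r e ¬y))

  reach-mono : ∀ {Y Z u v} → _⊆_ G Z Y → Reach G Y u v → Reach G Z u v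
  reach-mono sub = reach-avoiding (λ u r z → reach-end r (sub u z))

  full-cong : ∀ {X Y d} → _≐_ G X Y → Full⟨ X ⟩ d → Full⟨ Y ⟩ d
  full-cong (xy , yx) (¬x , nb) = ¬x ∘ yx _ , λ y y∈ →
    let v , r , e = nb y (yx y y∈) in v , reach-mono yx r , e

  tight-cong : ∀ {X Y} → _≐_ G X Y → Tight X → Tight Y
  tight-cong eq (d , e , fd , fe , ¬r) =
    d , e , full-cong eq fd , full-cong eq fe , ¬r ∘ reach-mono (proj₁ eq)

  misses-cong : ∀ {X X′ Y} → _≐_ G X X′ → X Misses Y → X′ Misses Y
  misses-cong eq (d , full , miss) =
    d , full-cong eq full , λ v r → miss v (reach-mono (proj₁ eq) r)

  misses-⊆ : ∀ {X Y Y′} → _⊆_ G Y′ Y → X Misses Y → X Misses Y′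
  misses-⊆ sub (d , full , miss) = d , full , λ v r → miss v r ∘ sub v

  -- The component of `d` in G - X avoids `Z`, hence stays connected in G - Z; as every vertex of
  -- `X` has a neighbour in it, the part of `X` outside `Z` is attached to it.
  misses-reach : ∀ {X Z d} → Full⟨ X ⟩ d → (∀ v → Reach G X d v → ¬ Z v) →
    ∀ x → X x → ¬ Z x → Reach G Z d x
  misses-reach (_ , nb) miss x x∈ ¬z =
    let v , r , e = nb x x∈ in step (reach-avoiding miss r) e ¬z

  -- Outside `Z`, the set `W` lies in the single component of `d` in G - Z. Of two distinct full
  -- components of `Z` at least one is different from that component and so avoids `W`.
  tight-misses : ∀ {Z W d} → Tight Z → (∀ w → W w → ¬ Z w → Reach G Z d w) → Z Misses W
  tight-misses {Z} {W} {d} (a , b , fa , fb , ¬r) to with em {Reach G Z a d}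
  ... | no ¬ad = a , fa , λ v av w → ¬ad (reach-trans av (reach-sym (to v w (reach-end av))))
  ... | yes ad = b , fb , λ v bv w →
    ¬r (reach-trans ad (reach-trans (to v w (reach-end bv)) (reach-sym bv)))

  misses-sym : ∀ {X Z} → Tight Z → X Misses Z → Z Misses X
  misses-sym tight (d , full , miss) = tight-misses tight (misses-reach full miss)

  -- The required component of G - Y is the one containing the full component of `X` that avoids
  -- `Y`.
  misses-nested : ∀ {X Y} → X Misses Y → ∃[ C ] (IsComponent G Y C × _⊆_ G X (_∪_ G C Y))
  misses-nested {X} {Y} (d , full , miss) =
    Reach G Y d , (d , miss d (here (proj₁ full)) , λ v → id , id) , within
    where
    within : ∀ v → X v → Reach G Y d v ⊎ Y v
    within v x with em {Y v}
    ... | yes y = inj₂ y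
    ... | no ¬y = inj₁ (misses-reach full miss v x ¬y)

  -- Full components of X and Y that avoid Z lie in one component of G − Z,
  -- because Y meets the one belonging to X.
  corner-misses : ∀ {X Y Z W} → Tight Z → ¬ X Misses Y → X Misses Z → Y Misses Z →
    _⊆_ G W (_∪_ G X Y) → Z Misses W
  corner-misses {X} {Y} {Z} {W} tight cross (d , fd , missd) (e , fe , misse) W⊆ =
    tight-misses tight to
    where
    meet-point : ∃[ y ] (Reach G X d y × Y y)
    meet-point = stable λ none → cross (d , fd , λ v r y → none (v , r , y))
    to : ∀ w → W w → ¬ Z w → Reach G Z d w
    to w w∈ ¬z with W⊆ w w∈
    ... | inj₁ x = misses-reach fd missd w x ¬z
    ... | inj₂ y = let y₀ , r , y₀∈ = meet-point in
      reach-trans (reach-avoiding missd r)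
        (reach-trans (reach-sym (misses-reach fe misse y₀ y₀∈ (missd y₀ r)))
          (misses-reach fe misse w y ¬z))

  -- Halin's argument: finitely many separators of bounded size cross a finite set.

  vertices : ∀ {Y u v} → Reach G Y u v → List V
  vertices {v = v} (here _) = v ∷ []
  vertices {v = v} (step r _ _) = v ∷ vertices r

  reach-meets : ∀ {F Y u v} → (r : Reach G F u v) → ¬ Reach G Y u v →
    ∃[ w ] (w ∈ vertices r × Y w × ¬ F w)
  reach-meets {v = v} (here ¬f) ¬r = v , here refl , stable (¬r ∘ here) , ¬f
  reach-meets {Y = Y} {u} (step {v = v} {w} r e ¬f) ¬r with em {Reach G Y u v}
  ... | yes q = w , here refl , stable (¬r ∘ step q e) , ¬f
  ... | no ¬q = let w , w∈ , y , ¬f = reach-meets r ¬q in w , there w∈ , y , ¬f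

  ⟦_⟧ : List V → VSet G
  ⟦ xs ⟧ v = v ∈ xs

  remove : ∀ (ys : List V) {w} → w ∈ ys → ∃[ zs ] (length ys ≡ suc (length zs) ×
    (∀ v → v ∈ ys → v ≡ w ⊎ v ∈ zs) × (∀ v → v ∈ zs → v ∈ ys))
  remove (y ∷ ys) (here refl) = ys , refl ,
    (λ { v (here e) → inj₁ e ; v (there v∈) → inj₂ v∈ }) , λ _ → there
  remove (y ∷ ys) (there w∈) with remove ys w∈
  ... | zs , len , to , from = y ∷ zs , cong suc len ,
    (λ { v (here e) → inj₂ (here e)
       ; v (there v∈) → [ inj₁ , inj₂ ∘ there ]′ (to v v∈) }) ,
    λ { v (here e) → here e ; v (there v∈) → there (from v v∈) }

  -- The state of the induction: `u` and `v` lie in different full components of G - Y, the vertices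
  -- of `F` are those of `Y` found so far, and at most `n` are still to be found.
  record TightAround (u v : V) (F : List V) (n : ℕ) (Y : VSet G) : Set where
    field
      rest : List V
      small : length rest ≤ n
      ⊇ : ∀ w → w ∈ F ⊎ w ∈ rest → Y w
      ⊆ : ∀ w → Y w → w ∈ F ⊎ w ∈ rest
      fullᵤ : ∀ y → Y y → ∃[ w ] (Reach G Y u w × E w y)
      fullᵥ : ∀ y → Y y → ∃[ w ] (Reach G Y v w × E w y)
      apart : ¬ Reach G Y u v

  -- Halin: a u–v path avoiding F meets Y in one of finitely many vertices, which may be added to F;
  -- if there is none, then F already is all of Y.
  finitely-many-tight : ∀ u v n F →
    Σ[ L ∈ List (VSet G) ] (∀ Y → TightAround u v F n Y → Any (_≐_ G Y) L)
  finitely-many-tight u v n F with em {Reach G ⟦ F ⟧ u v}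
  ... | no ¬path = ⟦ F ⟧ ∷ [] , λ Y t → let open TightAround t in
    -- A vertex of `Y` outside `F` has neighbours in the components of `u` and of `v` in G - Y,
    -- which would yield a path from `u` to `v` avoiding `F`.
    here ((λ y y∈ → stable λ y∉F →
        let w , r , e = fullᵤ y y∈ ; w′ , r′ , e′ = fullᵥ y y∈
            F⊆Y : _⊆_ G ⟦ F ⟧ Y
            F⊆Y = λ z z∈ → ⊇ z (inj₁ z∈)
        in ¬path (reach-trans (step (reach-mono F⊆Y r) e y∉F)
             (reach-sym (step (reach-mono F⊆Y r′) e′ y∉F)))) ,
      λ y y∈ → ⊇ y (inj₁ y∈))
  finitely-many-tight u v zero F | yes path = [] , λ Y t → let open TightAround t in
    let w , _ , y , w∉F = reach-meets path apart in
    ⊥-elim ([ w∉F , (λ w∈ → absurd rest small w∈) ]′ (⊆ w y))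
    where
    absurd : ∀ (xs : List V) {w} → length xs ≤ 0 → w ∈ xs → ⊥
    absurd [] _ ()
    absurd (_ ∷ _) () _
  finitely-many-tight u v (suc n) F | yes path =
    concat (map branch (vertices path)) , λ Y t → let open TightAround t in
    let w , w∈p , y , w∉F = reach-meets path apart
        w∈ = [ (λ w∈F → contradiction w∈F w∉F) , id ]′ (⊆ w y)
        zs , len , to , from = remove rest w∈
        t′ : TightAround u v (w ∷ F) n Y
        t′ = record
          { rest = zs ; small = ≤-pred (≤-trans (≤-reflexive (sym len)) small)
          ; ⊇ = λ { x (inj₁ (here refl)) → y
                  ; x (inj₁ (there x∈)) → ⊇ x (inj₁ x∈)
                  ; x (inj₂ x∈) → ⊇ x (inj₂ (from x x∈)) }
          ; ⊆ = λ x x∈ → [ inj₁ ∘ there , [ inj₁ ∘ here , inj₂ ]′ ∘ to x ]′ (⊆ x x∈)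
          ; fullᵤ = fullᵤ ; fullᵥ = fullᵥ ; apart = apart }
    in Anyₚ.concat⁺ (lose (∈-map⁺ branch w∈p) (proj₂ (finitely-many-tight u v n (w ∷ F)) Y t′))
    where
    branch : V → List (VSet G)
    branch w = proj₁ (finitely-many-tight u v n (w ∷ F))

  -- If `Z` crosses `X`, then both of its full components meet `X`, so `Z` separates some `u` and
  -- `v` in `X`. There are finitely many such pairs, and finitely many `Z` for each of them.
  finitely-many-crossing : ∀ {X} → Finite G X → ∀ n →
    ∃[ m ] Covers (_≐_ G) (λ Z → (Tight Z × ∃[ k ] (HasSize G Z k × k ≤ n)) × ¬ Z Misses X) m
  finitely-many-crossing {X} (_ , xs , _ , _ , mem) n = length L , L , ≤-refl , cov
    where
    cell : V → V → List (VSet G)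
    cell u v = proj₁ (finitely-many-tight u v n [])
    L = concat (cartesianProductWith cell xs xs)
    hit : ∀ {Z d} → ¬ Z Misses X → Full⟨ Z ⟩ d → ∃[ x ] (Reach G Z d x × X x)
    hit {d = d} cross full = stable λ none → cross (d , full , λ v r x → none (v , r , x))
    cov : ∀ Z → (Tight Z × ∃[ k ] (HasSize G Z k × k ≤ n)) × ¬ Z Misses X → Any (_≐_ G Z) L
    cov Z (((d , e , fd , fe , ¬r) , _ , (zs , len , _ , memZ) , k≤n) , cross) =
      let u , ru , xu = hit cross fd
          v , rv , xv = hit cross fe
          t : TightAround u v [] n Z
          t = record
            { rest = zs ; small = ≤-trans (≤-reflexive len) k≤n
            ; ⊇ = λ { w (inj₂ w∈) → proj₂ (memZ w) w∈ }
            ; ⊆ = λ w → inj₂ ∘ proj₁ (memZ w)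
            ; fullᵤ = λ y y∈ → let w , r , a = proj₂ fd y y∈ in w , reach-trans (reach-sym ru) r , a
            ; fullᵥ = λ y y∈ → let w , r , a = proj₂ fe y y∈ in w , reach-trans (reach-sym rv) r , a
            ; apart = λ r → ¬r (reach-trans ru (reach-trans r (reach-sym rv))) }
      in Anyₚ.concat⁺ (lose (∈-cartesianProductWith⁺ cell (proj₁ (mem u) xu) (proj₁ (mem v) xv))
           (proj₂ (finitely-many-tight u v n []) Z t))

-- Separations and their corners.

module Uncrossing (em : ExcludedMiddle 0ℓ) (em₁ : ExcludedMiddle (lsuc 0ℓ)) (G : Graph) where
  open Graph G
  open Notions G
  open Separators em G

  _⁻ : Sep G → Sep G
  s ⁻ = inv G s

  ∂ : Sep G → VSet G
  ∂ = separator G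

  ∂-inv : ∀ s → _≐_ G (∂ s) (∂ (s ⁻))
  ∂-inv s = (λ _ → swap) , (λ _ → swap)

  ≐-sym : ∀ {X Y} → _≐_ G X Y → _≐_ G Y X
  ≐-sym = swap

  ≐-trans : ∀ {X Y Z} → _≐_ G X Y → _≐_ G Y Z → _≐_ G X Z
  ≐-trans (f , g) (f′ , g′) = (λ v → f′ v ∘ f v) , λ v → g v ∘ g′ v

  inv-sep : ∀ {s} → IsSeparation G s → IsSeparation G (s ⁻)
  inv-sep (cover , noEdge) =
    (λ v → [ inj₂ , inj₁ ]′ (cover v)) ,
    λ u v b ¬a a ¬b e → noEdge v u a ¬b b ¬a (E-sym e)

  inv-order : ∀ s {k} → HasOrder G s k → HasOrder G (s ⁻) k
  inv-order s = hasSize-cong (∂-inv s)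

  join-sep : ∀ {s t} → IsSeparation G s → IsSeparation G t → IsSeparation G (join G s t)
  join-sep {A , B} {C , D} (cover , noEdge) (cover′ , noEdge′) = cov , no-edge
    where
    cov : ∀ v → (A v ⊎ C v) ⊎ (B v × D v)
    cov v with cover v | cover′ v
    ... | inj₁ a | _      = inj₁ (inj₁ a)
    ... | inj₂ _ | inj₁ c = inj₁ (inj₂ c)
    ... | inj₂ b | inj₂ d = inj₂ (b , d)
    no-edge : ∀ u v → A u ⊎ C u → ¬ (B u × D u) → B v × D v → ¬ (A v ⊎ C v) → ¬ E u v
    no-edge u v _ ¬bd (b , d) ¬ac e with em {B u} | em {D u}
    ... | yes bu | yes du = ¬bd (bu , du)
    ... | no ¬bu | _ = noEdge u v ([ id , (λ bu → contradiction bu ¬bu) ]′ (cover u)) ¬bu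
      b (¬ac ∘ inj₁) e
    ... | _ | no ¬du = noEdge′ u v ([ id , (λ du → contradiction du ¬du) ]′ (cover′ u)) ¬du
      d (¬ac ∘ inj₂) e

  ∂-join : ∀ s t → _⊆_ G (∂ (join G s t)) (_∪_ G (∂ s) (∂ t))
  ∂-join s t v (inj₁ a , b , d) = inj₁ (a , b)
  ∂-join s t v (inj₂ c , b , d) = inj₂ (c , d)

  -- Submodularity of the order; `join G (s ⁻) (t ⁻)` is the inverse of the meet. A vertex in both
  -- corner separators lies in both `∂ s` and `∂ t`.
  opposite-corners-order : ∀ s t {n m} → HasOrder G s n → HasOrder G t m →
    ∃[ a ] ∃[ b ] (HasOrder G (join G s t) a × HasOrder G (join G (s ⁻) (t ⁻)) b × a + b ≤ n + m)
  opposite-corners-order s t os ot =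
    let a , b , ca , cb , le , _ = covers-submodular em _≡_ sym
          (∂ s) (∂ t) (∂ (join G s t)) (∂ (join G (s ⁻) (t ⁻)))
          (λ { refl → id }) (λ { refl → id }) (λ { refl → id }) (λ { refl → id })
          (∂-join s t)
          (λ { v (inj₁ b , a , c) → inj₁ (a , b) ; v (inj₂ d , a , c) → inj₂ (c , d) })
          (λ { v (_ , b , d) (_ , a , c) → (a , b) , (c , d) })
          (hasSize⇒covers os) (hasSize⇒covers ot)
        a′ , ha , a′≤a = covers⇒hasSize ca
        b′ , hb , b′≤b = covers⇒hasSize cb
    in a′ , b′ , ha , hb , ≤-trans (+-mono-≤ a′≤a b′≤b) le

  reach-side : ∀ {A B d v} → IsSeparation G (A , B) → B d → ¬ A d →
    Reach G (_∩_ G A B) d v → B v × ¬ A v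
  reach-side sep b ¬a (here _) = b , ¬a
  reach-side {A} {B} sep b ¬a (step {v = v} {w} r e ¬x) with reach-side sep b ¬a r | em {A w}
  ... | bv , ¬av | yes aw = ⊥-elim (proj₂ sep w v aw (λ bw → ¬x (aw , bw)) bv ¬av (E-sym e))
  ... | bv , ¬av | no ¬aw = [ (λ aw → contradiction aw ¬aw) , id ]′ (proj₁ sep w) , ¬aw

  -- Profiles up to a given order.

  record Decides (P : SepPred G) (k : ℕ) : Set₁ where
    field
      respects : Respects G P
      isSep    : ∀ {s} → P s → IsSeparation G s
      orient   : ∀ {s m} → IsSeparation G s → HasOrder G s m → m ≤ k → P s ⊎ P (s ⁻)
      -- Consistency and the profile property are recast as closure under smaller separations and
      -- under joins, as long as the order is at most `k`.
      down     : ∀ {r t m} → P t → IsSeparation G r → HasOrder G r m → m ≤ k →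
                 _≤s_ G r t → P r
      joins    : ∀ {s t m} → P s → P t → HasOrder G (join G s t) m → m ≤ k → P (join G s t)
      regular  : Regular G P
      robust   : Robust G P

  RobustRegular : SepPred G → Set₁
  RobustRegular P = IsProfile G P × Robust G P × Regular G P

  -- The separation `s` shows that the order bound `κ` of the profile exceeds `k`, so that all
  -- separations of order at most `k` are oriented.
  robustRegular-decides : ∀ {P k s} → RobustRegular P → P s →
    (∀ m → HasOrder G s m → k ≤ m) → Decides P k
  robustRegular-decides {P} {k} {s} ((κ , resp , inS , total , exclusive , consistent , profile) , rob , reg)
    p min = record
      { respects = resp ; isSep = proj₁ ∘ inS _ ; orient = orient ; down = down
      ; joins = λ {s} {t} ps pt o m≤k → [ id , (λ q → ⊥-elim (profile s t ps pt q)) ]′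
          (orient (join-sep (proj₁ (inS _ ps)) (proj₁ (inS _ pt))) o m≤k)
      ; regular = reg ; robust = rob }
    where
    below : ∀ {t m} → HasOrder G t m → m ≤ k → OrderBelow G t κ
    below {t} {m} o m≤k = go κ (proj₂ (inS s p))
      where
      go : ∀ κ → OrderBelow G s κ → OrderBelow G t κ
      go (fin l) (n , on , n<l) = m , o , ≤-<-trans (≤-trans m≤k (min n on)) n<l
      go ℵ₀ _ = m , o
    orient : ∀ {s m} → IsSeparation G s → HasOrder G s m → m ≤ k → P s ⊎ P (s ⁻)
    orient sep o m≤k = total _ (sep , below o m≤k)
    down : ∀ {r t m} → P t → IsSeparation G r → HasOrder G r m → m ≤ k → _≤s_ G r t → P r
    down {r} {t} pt sep o m≤k r≤t with orient sep o m≤k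
    ... | inj₁ pr = pr
    ... | inj₂ pr⁻ with em {SameUnoriented G (r ⁻) t}
    ... | no ¬same = ⊥-elim (consistent (r ⁻) t pr⁻ pt ¬same r≤t)
    ... | yes (inj₂ (eqB , eqA)) = resp t r (≐-sym eqA , ≐-sym eqB) pt
    -- Here `r ⁻` equals `t`, so the first side of `t` contains both sides of `r` and is the whole
    -- vertex set, contrary to regularity.
    ... | yes (inj₁ ((B⊆C , _) , _)) = ⊥-elim (reg (proj₂ t) (resp t (Full G , proj₂ t)
      (((λ _ _ → _) , λ v _ → [ proj₁ r≤t v , B⊆C v ]′ (proj₁ sep v)) , (λ _ → id) , λ _ → id) pt))

  eff-flip : ∀ {P Q k s} → Eff P Q k s → Eff Q P k (s ⁻)
  eff-flip {s = s} e = record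
    { isSep = inv-sep isSep ; inP = inQ ; inQ = inP ; order = inv-order s order
    ; minimal = λ { t m (sep , inj₁ (q , p)) → minimal t m (sep , inj₂ (p , q))
                  ; t m (sep , inj₂ (q , p)) → minimal t m (sep , inj₁ (p , q)) } }
    where open Eff e

  eff-decidesˡ : ∀ {P Q k s} → RobustRegular P → Eff P Q k s → Decides P k
  eff-decidesˡ rr e = robustRegular-decides rr inP λ m o → minimal _ m (isSep , inj₁ (inP , inQ)) o
    where open Eff e

  eff-decidesʳ : ∀ {P Q k s} → RobustRegular Q → Eff P Q k s → Decides Q k
  eff-decidesʳ rr e = eff-decidesˡ rr (eff-flip e)

  -- Full components on the sides of efficient separations.

  FullIn : VSet G → VSet G → Set
  FullIn X B = ∃[ d ] (Full⟨ X ⟩ d × (∀ v → Reach G X d v → B v))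

  fullIn-cong : ∀ {X Y B} → _≐_ G X Y → FullIn X B → FullIn Y B
  fullIn-cong eq (d , full , inB) = d , full-cong eq full , λ v r → inB v (reach-mono (proj₁ eq) r)

  -- If no component in B ∖ A had all of X as its neighbourhood, then B ∖ A would be the union over
  -- x ∈ X of the sets U x of vertices whose component does not see x.  Each U x is cut off by
  -- X ∖ {x}, so by efficiency P and Q agree on it, and adding all U x to A puts (V , X) into P.
  eff-full : ∀ {P Q k s} → Decides P k → Decides Q k → Eff P Q k s → FullIn (∂ s) (proj₂ s)
  eff-full {P} {Q} {k} {A , B} dP dQ eff = stable absurd
    where
    open Eff eff
    module dP = Decides dP
    module dQ = Decides dQ
    X = ∂ (A , B)
    U : V → VSet G
    U x v = B v × ¬ A v × (∀ w → Reach G X v w → ¬ E w x)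
    cut : V → Sep G
    cut x = (λ v → U x v ⊎ (X v × v ≢ x)) , λ v → ¬ U x v
    cut-sep : ∀ x → IsSeparation G (cut x)
    cut-sep x = cover , noEdge
      where
      cover : ∀ v → (U x v ⊎ (X v × v ≢ x)) ⊎ ¬ U x v
      cover v with em {U x v}
      ... | yes u = inj₁ (inj₁ u)
      ... | no ¬u = inj₂ ¬u
      noEdge : ∀ u v → U x u ⊎ (X u × u ≢ x) → ¬ ¬ U x u → ¬ U x v →
        ¬ (U x v ⊎ (X v × v ≢ x)) → ¬ E u v
      -- A neighbour of `U x` that lies in `X` but not on the first side must be `x`, which no
      -- component in `U x` sees. A neighbour in B minus A is in the same component and thus in
      -- `U x` itself.
      noEdge u v _ ¬¬u ¬uv ¬v e with stable ¬¬u | em {A v} | em {B v}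
      ... | bu , ¬au , _  | yes av | no ¬bv = proj₂ isSep v u av ¬bv bu ¬au (E-sym e)
      ... | bu , ¬au , no-nb | yes av | yes bv =
        no-nb u (here λ { (au , _) → ¬au au })
          (subst (E u) (stable λ v≢x → ¬v (inj₂ ((av , bv) , v≢x))) e)
      ... | _ | no ¬av | no ¬bv = [ ¬av , ¬bv ]′ (proj₁ isSep v)
      ... | bu , ¬au , no-nb | no ¬av | yes bv = ¬uv (bv , ¬av , λ w r →
        no-nb w (reach-trans (step (here λ { (au , _) → ¬au au }) e (λ { (av , _) → ¬av av })) r))
    cut-order : ∀ x → X x → ∃[ m ] (HasOrder G (cut x) m × m < k)
    cut-order x x∈ =
      let m , m<k , cov = covers-remove em _≡_ sym {X} {λ v → X v × v ≢ x} (λ { refl → id })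
            (λ _ → proj₁) x x∈ (λ { (_ , x≢x) → x≢x refl }) (hasSize⇒covers order)
          l , size , l≤m = covers⇒hasSize
            (covers-mono (λ { v (inj₁ u , ¬u) → contradiction u ¬u ; v (inj₂ y , _) → y }) ≤-refl cov)
      in l , size , ≤-<-trans l≤m m<k
    cut∈P : ∀ x → X x → P (cut x)
    cut∈P x x∈ with cut-order x x∈
    ... | m , o , m<k with dP.orient (cut-sep x) o (<⇒≤ m<k)
    ... | inj₁ p = p
    -- Since `cut x` is below the inverse of the given separation, it belongs to `Q`; its inverse in
    -- `P` would make it a distinguisher of order less than `k`.
    ... | inj₂ p⁻ = contradiction (minimal (cut x) m (cut-sep x , inj₂ (p⁻ , cut∈Q)) o) (<⇒≱ m<k)
      where
      cut∈Q : Q (cut x)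
      cut∈Q = dQ.down inQ (cut-sep x) o (<⇒≤ m<k)
        ((λ { v (inj₁ (b , _)) → b ; v (inj₂ ((_ , b) , _)) → b }) ,
         λ { v a (_ , ¬a , _) → ¬a a })
    -- The separator is kept inside `X` so that its order stays at most `k` and the next join still
    -- belongs to `P`.
    Grown : List V → Set₁
    Grown ys = ∃[ s ] (P s × _⊆_ G A (proj₁ s) × _⊆_ G (∂ s) X ×
      (∀ y → y ∈ ys → _⊆_ G (U y) (proj₁ s)))
    grow : ∀ ys → (∀ y → y ∈ ys → X y) → Grown ys
    grow [] _ = (A , B) , inP , (λ _ → id) , (λ _ → id) , λ _ ()
    grow (y ∷ ys) ys⊆ with grow ys (λ z → ys⊆ z ∘ there)
    ... | s , ps , A⊆ , ∂⊆ , U⊆ =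
      join G s (cut y) ,
      dP.joins ps (cut∈P y (ys⊆ y (here refl))) (proj₁ (proj₂ size)) (proj₂ (proj₂ size)) ,
      (λ v → inj₁ ∘ A⊆ v) , ∂⊆′ ,
      λ { z (here refl) v u → inj₂ (inj₁ u) ; z (there z∈) v u → inj₁ (U⊆ z z∈ v u) }
      where
      ∂⊆′ : _⊆_ G (∂ (join G s (cut y))) X
      ∂⊆′ v (inj₁ a , b , _) = ∂⊆ v (a , b)
      ∂⊆′ v (inj₂ (inj₁ u) , _ , ¬u) = contradiction u ¬u
      ∂⊆′ v (inj₂ (inj₂ (x , _)) , _) = x
      size = hasSize-⊆ ∂⊆′ order
    absurd : ¬ ¬ FullIn X B
    absurd none with order
    ... | xs , _ , _ , mem with grow xs (λ y → proj₂ (mem y))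
    ... | (A′ , B′) , p , A⊆ , _ , U⊆ =
      dP.regular B′ (dP.respects (A′ , B′) (Full G , B′)
        (((λ _ _ → _) , λ v _ → all v) , (λ _ → id) , λ _ → id) p)
      where
      all : ∀ v → A′ v
      all v with em {A v}
      ... | yes a = A⊆ v a
      ... | no ¬a = stable λ ¬a′ → none (v , ((λ { (a , _) → ¬a a }) , λ x x∈ →
          stable λ ¬nb → ¬a′ (U⊆ x (proj₁ (mem x) x∈) v (b , ¬a , λ w r e → ¬nb (w , r , e)))) ,
          λ w r → proj₁ (reach-side isSep b ¬a r))
        where
        b : B v
        b = [ (λ a → contradiction a ¬a) , id ]′ (proj₁ isSep v)

  Sided : Sep G → Set
  Sided s = FullIn (∂ s) (proj₁ s) × FullIn (∂ s) (proj₂ s)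

  sided-flip : ∀ {s} → Sided s → Sided (s ⁻)
  sided-flip {s} (fA , fB) = fullIn-cong (∂-inv s) fB , fullIn-cong (∂-inv s) fA

  eff-sided : ∀ {P Q k s} → Decides P k → Decides Q k → Eff P Q k s → Sided s
  eff-sided {s = s} dP dQ eff =
    fullIn-cong (∂-inv (s ⁻)) (eff-full dQ dP (eff-flip eff)) , eff-full dP dQ eff

  sided-tight : ∀ {s} → Sided s → Tight (∂ s)
  sided-tight ((d , fd , inA) , (e , fe , inB)) = d , e , fd , fe ,
    λ r → reach-end r (inA e r , inB e (here (proj₁ fe)))

  fullIn-misses : ∀ {s Z} → FullIn (∂ s) (proj₂ s) → _⊆_ G Z (proj₁ s) → ∂ s Misses Z
  fullIn-misses (d , full , inB) Z⊆A = d , full , λ v r z → reach-end r (Z⊆A v z , inB v r)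

  -- A full component of `Z` avoiding `∂ s` lies strictly on one side of `s`, and all vertices of
  -- `Z` outside `∂ s` are attached to it.
  misses-within-side : ∀ {s Z} → IsSeparation G s → Z Misses ∂ s →
    _⊆_ G Z (proj₁ s) ⊎ _⊆_ G Z (proj₂ s)
  misses-within-side {A , B} {Z} sep (z , full , miss) with em {A z}
  ... | yes a = inj₁ inA
    where
    to = misses-reach full miss
    inA : ∀ v → Z v → A v
    inA v v∈ with em {A v × B v}
    ... | yes (a , _) = a
    ... | no ¬x = proj₁ (reach-side (inv-sep sep) a (λ b → miss z (here (proj₁ full)) (a , b))
      (reach-mono (λ _ → swap) (to v v∈ ¬x)))
  ... | no ¬a = inj₂ inB
    where
    to = misses-reach full miss
    inB : ∀ v → Z v → B v
    inB v v∈ with em {A v × B v}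
    ... | yes (_ , b) = b
    ... | no ¬x = proj₁ (reach-side sep ([ (λ a → contradiction a ¬a) , id ]′ (proj₁ sep z)) ¬a
      (to v v∈ ¬x))

  -- Uncrossing from a separator of lower order.

  corner-distinguishes : ∀ {P Q k s t m} → Decides P k → Decides Q k → P s → P t →
    Q (s ⁻) ⊎ Q (t ⁻) → HasOrder G (join G s t) m → m ≤ k →
    P (join G s t) × Q (join G s t ⁻)
  corner-distinguishes {s = s} {t} dP dQ ps pt q o m≤k = joins ps pt o m≤k , opposite q
    where
    open Decides dP
    module dQ = Decides dQ
    c = join G s t
    -- The inverse of the corner is below both `s ⁻` and `t ⁻`, so either of these in `Q` suffices.
    opposite : _ → _
    opposite (inj₁ qs) = dQ.down qs (inv-sep (join-sep (isSep ps) (isSep pt))) (inv-order c o) m≤k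
      ((λ _ → proj₁) , λ _ → inj₁)
    opposite (inj₂ qt) = dQ.down qt (inv-sep (join-sep (isSep ps) (isSep pt))) (inv-order c o) m≤k
      ((λ _ → proj₂) , λ _ → inj₂)

  +-cancel-bound : ∀ {a b k l} → a + b ≤ k + l → l < a → b < k
  +-cancel-bound {a} {b} {k} {l} le l<a = +-cancelˡ-< l b k
    (≤-trans (+-monoˡ-≤ b l<a) (≤-trans le (≤-reflexive (+-comm k l))))

  -- Both `Q₁` and `Q₂` contain `s`, so each of the corners `c₁` and `c₂` distinguishes them if its
  -- order is at most `l`. Otherwise the corners opposite to both have order less than `k` by
  -- submodularity, and robustness of `P₂` at `s ⁻` puts one of them into `P₂`, contrary to the
  -- efficiency of `s`.
  uncross-lower-oriented : ∀ {P₁ P₂ Q₁ Q₂ k l s t} →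
    Decides P₁ k → Decides P₂ k → Decides Q₁ l → Decides Q₂ l →
    Eff P₁ P₂ k s → Eff Q₁ Q₂ l t → Q₁ s → Q₂ s →
    ∃[ r ] (Eff Q₁ Q₂ l r × _⊆_ G (∂ r) (_∪_ G (∂ s) (∂ t)) × _⊆_ G (∂ r) (proj₂ s))
  uncross-lower-oriented {P₁} {P₂} {Q₁} {Q₂} {k} {l} {s} {t} dP₁ dP₂ dQ₁ dQ₂ es et q₁ q₂ = result
    where
    module es = Eff es
    module et = Eff et
    c₁ = join G s t
    c₂ = join G s (t ⁻)
    minimal-corner : ∀ {r m} → IsSeparation G r → Q₁ r → Q₂ (r ⁻) → HasOrder G r m → m ≤ l →
      Eff Q₁ Q₂ l r
    minimal-corner {r} {m} sep p q o m≤l = record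
      { isSep = sep ; inP = p ; inQ = q
      ; order = subst (HasOrder G r) (≤-antisym m≤l (et.minimal r m (sep , inj₁ (p , q)) o)) o
      ; minimal = et.minimal }
    -- The inverse of this corner is below `s` and hence in `P₁`, so the corner would distinguish
    -- `P₁` from `P₂`.
    no-lower : ∀ {t m} → IsSeparation G t → HasOrder G (join G (s ⁻) t) m → m < k →
      ¬ P₂ (join G (s ⁻) t)
    no-lower {t} {m} sep o m<k p = <⇒≱ m<k (es.minimal _ m
      (join-sep (inv-sep es.isSep) sep , inj₂ (Decides.down dP₁ es.inP
        (inv-sep (join-sep (inv-sep es.isSep) sep)) (inv-order _ o) (<⇒≤ m<k)
        ((λ _ → proj₁) , λ _ → inj₁) , p)) o)
    result : ∃[ r ] (Eff Q₁ Q₂ l r × _⊆_ G (∂ r) (_∪_ G (∂ s) (∂ t)) × _⊆_ G (∂ r) (proj₂ s))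
    result with opposite-corners-order s t es.order et.order
              | opposite-corners-order s (t ⁻) es.order (inv-order t et.order)
    ... | a , b , oa , ob , ab | a′ , b′ , oa′ , ob′ , ab′ with a ≤? l | a′ ≤? l
    ... | yes a≤l | _ =
      let p , q = corner-distinguishes dQ₁ dQ₂ q₁ et.inP (inj₂ et.inQ) oa a≤l
      in c₁ , minimal-corner (join-sep es.isSep et.isSep) p q oa a≤l , ∂-join s t , λ v → proj₁ ∘ proj₂
    ... | no _ | yes a′≤l =
      let p , q = corner-distinguishes dQ₂ dQ₁ q₂ et.inQ (inj₂ et.inP) oa′ a′≤l
      in c₂ ⁻ , minimal-corner (inv-sep (join-sep es.isSep (inv-sep et.isSep))) q p (inv-order c₂ oa′) a′≤l ,
         (λ { v ((b , c) , inj₁ a) → inj₁ (a , b) ; v ((b , c) , inj₂ d) → inj₂ (c , d) }) ,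
         λ v → proj₁ ∘ proj₁
    ... | no a≰l | no a′≰l = ⊥-elim ([ no-lower et.isSep ob′ b′<k , no-lower (inv-sep et.isSep) ob b<k ]′
      (Decides.robust dP₂ _ _ es.inQ _ _ et.isSep (l , et.order) k b′ b (inv-order s es.order)
        ob′ b′<k ob b<k))
      where
      b<k = +-cancel-bound {a} ab (≰⇒> a≰l)
      b′<k = +-cancel-bound {a′} ab′ (≰⇒> a′≰l)

  -- As k < l, efficiency of `t` forces `Q₁` and `Q₂` to orient `s` alike. The separator of the
  -- resulting corner lies on one side of `s`, and `∂ s` has a full component on the other.
  uncross-lower : ∀ {P₁ P₂ Q₁ Q₂ k l s t} →
    Decides P₁ k → Decides P₂ k → Decides Q₁ l → Decides Q₂ l →
    Eff P₁ P₂ k s → Eff Q₁ Q₂ l t → k < l →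
    ∃[ r ] (Eff Q₁ Q₂ l r × _⊆_ G (∂ r) (_∪_ G (∂ s) (∂ t)) × ∂ s Misses ∂ r)
  uncross-lower {P₁} {P₂} {Q₁} {Q₂} {k} {l} {s} {t} dP₁ dP₂ dQ₁ dQ₂ es et k<l
    with Decides.orient dQ₁ (Eff.isSep es) (Eff.order es) (<⇒≤ k<l)
       | Decides.orient dQ₂ (Eff.isSep es) (Eff.order es) (<⇒≤ k<l)
  ... | inj₁ q₁ | inj₁ q₂ =
    let r , er , r⊆ , r⊆B = uncross-lower-oriented dP₁ dP₂ dQ₁ dQ₂ es et q₁ q₂
    in r , er , r⊆ , misses-cong (∂-inv (s ⁻))
         (fullIn-misses {s ⁻} (eff-full dP₂ dP₁ (eff-flip es)) r⊆B)
  ... | inj₂ q₁ | inj₂ q₂ =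
    let r , er , r⊆ , r⊆A = uncross-lower-oriented dP₂ dP₁ dQ₁ dQ₂ (eff-flip es) et q₁ q₂
    in r , er , (λ v → [ inj₁ ∘ swap , inj₂ ]′ ∘ r⊆ v) , fullIn-misses {s} (eff-full dP₁ dP₂ es) r⊆A
  ... | inj₁ q₁ | inj₂ q₂ =
    contradiction (Eff.minimal et s k (Eff.isSep es , inj₁ (q₁ , q₂)) (Eff.order es)) (<⇒≱ k<l)
  ... | inj₂ q₁ | inj₁ q₂ =
    contradiction (Eff.minimal et s k (Eff.isSep es , inj₂ (q₁ , q₂)) (Eff.order es)) (<⇒≱ k<l)

  -- Uncrossing at equal order, measured by crossing numbers.

  module _ (T : VSet G → Set₁) (T-tight : ∀ {X} → T X → Tight X)
    (T-cong : ∀ {X Y} → _≐_ G X Y → T X → T Y) where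

    crossingNumber-cong : ∀ {X Y n} → _≐_ G X Y → CrossingNumber≤ T X n → CrossingNumber≤ T Y n
    crossingNumber-cong (_ , Y⊆X) =
      covers-mono (λ { Z (tz , cross) → tz , cross ∘ misses-⊆ Y⊆X }) ≤-refl

    -- A Z that is nested with both X and Y is nested with both corners; a Z that is nested with one
    -- of them lies on one side of it and hence is nested with the corner on the other side.
    -- Strictness comes from Z = Y, which crosses X but neither corner.
    opposite-corners-crossing : ∀ {s t X Y n m} → IsSeparation G s → IsSeparation G t →
      _≐_ G (∂ s) X → _≐_ G (∂ t) Y → T X → T Y → ¬ X Misses Y →
      Sided t → Sided (join G s t) → Sided (join G (s ⁻) (t ⁻)) →
      CrossingNumber≤ T X n → CrossingNumber≤ T Y m →
      ∃[ a ] ∃[ b ] (CrossingNumber≤ T (∂ (join G s t)) a ×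
        CrossingNumber≤ T (∂ (join G (s ⁻) (t ⁻))) b × a + b < n + m)
    opposite-corners-crossing {s} {t} {X} {Y} seps sept eqX eqY TX TY cross sided-t sided-c sided-c̄ cX cY =
      let a , b , ca , cb , _ , strict = covers-submodular em₁ (_≐_ G) ≐-sym
            (Crosses X) (Crosses Y) (Crosses (∂ c)) (Crosses (∂ c̄)) resp resp resp resp
            (at-least-one (λ v → [ inj₁ ∘ proj₁ eqX v , inj₂ ∘ proj₁ eqY v ]′ ∘ ∂-join s t v))
            (at-least-one (λ v → [ inj₁ ∘ proj₁ eqX v ∘ swap , inj₂ ∘ proj₁ eqY v ∘ swap ]′
              ∘ ∂-join (s ⁻) (t ⁻) v))
            both cX cY
      in a , b , ca , cb , strict Y (TY , cross ∘ misses-sym (T-tight TX))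
           (λ { (_ , ¬m) → ¬m (misses-cong eqY (misses-cong (∂-inv (t ⁻))
             (fullIn-misses {t ⁻} (proj₂ (sided-flip sided-t)) (λ v → proj₂ ∘ proj₂)))) })
           (λ { (_ , ¬m) → ¬m (misses-cong eqY (fullIn-misses {t} (proj₂ sided-t) (λ v → proj₂ ∘ proj₂))) })
      where
      c = join G s t
      c̄ = join G (s ⁻) (t ⁻)
      Crosses : VSet G → VSet G → Set₁
      Crosses U Z = T Z × ¬ Z Misses U
      resp : ∀ {U Z Z′} → _≐_ G Z Z′ → Crosses U Z → Crosses U Z′
      resp eq (tz , ¬m) = T-cong eq tz , ¬m ∘ misses-cong (≐-sym eq)
      at-least-one : ∀ {W} → _⊆_ G W (_∪_ G X Y) → ∀ Z → Crosses W Z → Crosses X Z ⊎ Crosses Y Z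
      at-least-one W⊆ Z (tz , ¬m) with em {Z Misses X} | em {Z Misses Y}
      ... | no ¬x | _     = inj₁ (tz , ¬x)
      ... | yes _ | no ¬y = inj₂ (tz , ¬y)
      ... | yes x | yes y = contradiction
        (corner-misses (T-tight tz) cross (misses-sym (T-tight TX) x) (misses-sym (T-tight TY) y) W⊆) ¬m
      side : ∀ {Z} → T Z → Crosses (∂ c) Z → Crosses (∂ c̄) Z →
        ¬ (_⊆_ G Z (proj₁ c) ⊎ _⊆_ G Z (proj₁ c̄))
      side tz (_ , ¬c) _ (inj₁ Z⊆) = ¬c (misses-sym (T-tight tz) (fullIn-misses {c} (proj₂ sided-c) Z⊆))
      side tz _ (_ , ¬c̄) (inj₂ Z⊆) = ¬c̄ (misses-sym (T-tight tz) (fullIn-misses {c̄} (proj₂ sided-c̄) Z⊆))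
      both : ∀ Z → Crosses (∂ c) Z → Crosses (∂ c̄) Z → Crosses X Z × Crosses Y Z
      both Z xc@(tz , _) xc̄ =
        (tz , λ mx → side tz xc xc̄ ([ (λ Z⊆ → inj₁ (λ v → inj₁ ∘ Z⊆ v)) , (λ Z⊆ → inj₂ (λ v → inj₁ ∘ Z⊆ v)) ]′
          (misses-within-side seps (misses-⊆ (proj₁ eqX) mx)))) ,
        (tz , λ my → side tz xc xc̄ ([ (λ Z⊆ → inj₁ (λ v → inj₂ ∘ Z⊆ v)) , (λ Z⊆ → inj₂ (λ v → inj₂ ∘ Z⊆ v)) ]′
          (misses-within-side sept (misses-⊆ (proj₁ eqY) my))))

    module _ {k n m : ℕ} {X Y : VSet G} (TX : T X) (TY : T Y) (cross : ¬ X Misses Y)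
      (cX : CrossingNumber≤ T X n) (cY : CrossingNumber≤ T Y m) where

      Corner : SepPred G → SepPred G → ℕ → Set₁
      Corner P Q a = ∃[ r ] (Eff P Q k r × _⊆_ G (∂ r) (_∪_ G X Y) × CrossingNumber≤ T (∂ r) a)

      Placed : Sep G → VSet G → Set
      Placed s Z = IsSeparation G s × Sided s × HasOrder G s k × _≐_ G (∂ s) Z

      flip : ∀ {s Z} → Placed s Z → Placed (s ⁻) Z
      flip {s} (sep , sided , o , eq) =
        inv-sep sep , sided-flip sided , inv-order s o , ≐-trans (∂-inv (s ⁻)) eq

      -- Having order at most k already forces c to be an efficient distinguisher.
      record Potential (P Q : SepPred G) (c : Sep G) : Set₁ where
        field
          decidesˡ : Decides P k
          decidesʳ : Decides Q k
          minimal  : ∀ t m → Distinguishes G t P Q → HasOrder G t m → k ≤ m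
          distinguishes : ∀ {m} → HasOrder G c m → m ≤ k → P c × Q (c ⁻)

      potential : ∀ {P Q s} → Eff P Q k s → Decides P k → Decides Q k → ∀ {c} →
        (∀ {m} → HasOrder G c m → m ≤ k → P c × Q (c ⁻)) → Potential P Q c
      potential eff dP dQ dist = record
        { decidesˡ = dP ; decidesʳ = dQ ; minimal = Eff.minimal eff ; distinguishes = dist }

      potential-order : ∀ {P Q c m} → IsSeparation G c → Potential P Q c → HasOrder G c m → k ≤ m
      potential-order {m = m} sep pot o with m ≤? k
      ... | yes m≤k = minimal _ m (sep , inj₁ (distinguishes o m≤k)) o
        where open Potential pot
      ... | no m≰k = <⇒≤ (≰⇒> m≰k)

      potential-eff : ∀ {P Q c} → IsSeparation G c → Potential P Q c → HasOrder G c k → Eff P Q k c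
      potential-eff sep pot o = record
        { isSep = sep ; inP = proj₁ (distinguishes o ≤-refl) ; inQ = proj₂ (distinguishes o ≤-refl)
        ; order = o ; minimal = minimal }
        where open Potential pot

      squeeze : ∀ {a b} → k ≤ a → k ≤ b → a + b ≤ k + k → a ≡ k × b ≡ k
      squeeze {a} {b} k≤a k≤b le =
        ≤-antisym (+-cancelʳ-≤ b a k (≤-trans le (+-monoʳ-≤ k k≤b))) k≤a ,
        ≤-antisym (+-cancelˡ-≤ a b k (≤-trans le (+-monoˡ-≤ k k≤a))) k≤b

      -- Both corners have order at least `k` and their orders add up to at most k + k, so both are
      -- equal to `k`. Hence both corners distinguish efficiently, have full components on both
      -- sides, and satisfy the strict inequality for crossing numbers.
      opposite-corners : ∀ {P P′ Q Q′ s t} → Placed s X → Placed t Y →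
        Potential P P′ (join G s t) → Potential Q Q′ (join G (s ⁻) (t ⁻)) →
        ∃[ a ] ∃[ b ] (Corner P P′ a × Corner Q Q′ b × a + b < n + m)
      opposite-corners {s = s} {t} (seps , _ , os , eqX) (sept , sided-t , ot , eqY) p q =
        let oa , ob = orders
            ep = potential-eff sepc p oa
            eq = potential-eff sepc̄ q ob
            a , b , ca , cb , lt = opposite-corners-crossing {s} {t} seps sept eqX eqY TX TY cross sided-t
              (eff-sided p.decidesˡ p.decidesʳ ep) (eff-sided q.decidesˡ q.decidesʳ eq) cX cY
        in a , b , (c , ep , (λ v → [ inj₁ ∘ proj₁ eqX v , inj₂ ∘ proj₁ eqY v ]′ ∘ ∂-join s t v) , ca) ,
           (c̄ , eq , (λ v → [ inj₁ ∘ proj₁ eqX v ∘ swap , inj₂ ∘ proj₁ eqY v ∘ swap ]′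
             ∘ ∂-join (s ⁻) (t ⁻) v) , cb) , lt
        where
        module p = Potential p
        module q = Potential q
        c = join G s t
        c̄ = join G (s ⁻) (t ⁻)
        sepc = join-sep seps sept
        sepc̄ = join-sep (inv-sep seps) (inv-sep sept)
        orders : HasOrder G c k × HasOrder G c̄ k
        orders with opposite-corners-order s t os ot
        ... | a , b , oa , ob , le with squeeze (potential-order sepc p oa) (potential-order sepc̄ q ob) le
        ... | refl , refl = oa , ob

      corner-flip : ∀ {P Q a} → Corner P Q a → Corner Q P a
      corner-flip (r , eff , r⊆ , cn) =
        r ⁻ , eff-flip eff , (λ v → r⊆ v ∘ swap) , crossingNumber-cong (∂-inv r) cn

      Improved : SepPred G → SepPred G → ℕ → Set₁
      Improved P Q l = ∃[ a ] (a < l × Corner P Q a)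

      -- The orientations of `t` by the `P` profiles and of `s` by the `Q` profiles tell which
      -- corners distinguish which pair. Either two opposite corners serve one pair each, or each
      -- pair is served by two opposite corners of its own.
      uncross-equal : ∀ {P₁ P₂ Q₁ Q₂ s t} →
        Decides P₁ k → Decides P₂ k → Decides Q₁ k → Decides Q₂ k →
        Eff P₁ P₂ k s → Eff Q₁ Q₂ k t → _≐_ G (∂ s) X → _≐_ G (∂ t) Y →
        Improved P₁ P₂ n ⊎ Improved Q₁ Q₂ m
      uncross-equal {P₁} {P₂} {Q₁} {Q₂} {s} {t} dP₁ dP₂ dQ₁ dQ₂ es et eqX eqY = result
        where
        module es = Eff es
        module et = Eff et
        S⁺ : Placed s X
        S⁺ = es.isSep , eff-sided dP₁ dP₂ es , es.order , eqX
        T⁺ : Placed t Y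
        T⁺ = et.isSep , eff-sided dQ₁ dQ₂ et , et.order , eqY
        S⁻ = flip S⁺
        T⁻ = flip T⁺
        p₁ : ∀ {r} → P₁ r → Potential P₁ P₂ (join G s r)
        p₁ pr = potential es dP₁ dP₂ (corner-distinguishes dP₁ dP₂ es.inP pr (inj₁ es.inQ))
        p₂ : ∀ {r} → P₂ r → Potential P₂ P₁ (join G (s ⁻) r)
        p₂ pr = potential (eff-flip es) dP₂ dP₁ (corner-distinguishes dP₂ dP₁ es.inQ pr (inj₁ es.inP))
        q₁ : ∀ {r} → Q₁ r → Potential Q₁ Q₂ (join G r t)
        q₁ qr = potential et dQ₁ dQ₂ (corner-distinguishes dQ₁ dQ₂ qr et.inP (inj₂ et.inQ))
        q₂ : ∀ {r} → Q₂ r → Potential Q₂ Q₁ (join G r (t ⁻))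
        q₂ qr = potential (eff-flip et) dQ₂ dQ₁ (corner-distinguishes dQ₂ dQ₁ qr et.inQ (inj₂ et.inP))
        one : ∀ {a b} → Corner P₁ P₂ a → Corner Q₁ Q₂ b → a + b < n + m →
          Improved P₁ P₂ n ⊎ Improved Q₁ Q₂ m
        one {a} {b} ca cb lt with +-<-split {a} {b} lt
        ... | inj₁ a<n = inj₁ (a , a<n , ca)
        ... | inj₂ b<m = inj₂ (b , b<m , cb)
        two : ∀ {a b a′ b′} → Corner P₁ P₂ a → Corner P₁ P₂ b → a + b < n + m →
          Corner Q₁ Q₂ a′ → Corner Q₁ Q₂ b′ → a′ + b′ < n + m →
          Improved P₁ P₂ n ⊎ Improved Q₁ Q₂ m
        -- The pair whose separator has the larger crossing number is improved: its two corners add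
        -- up to less than twice that number.
        two {a} {b} {a′} {b′} ca cb lt ca′ cb′ lt′ with ≤-total n m
        ... | inj₁ n≤m = inj₂ ([ (λ h → a′ , h , ca′) , (λ h → b′ , h , cb′) ]′
          (+-<-split {a′} {b′} (≤-trans lt′ (+-monoˡ-≤ m n≤m))))
        ... | inj₂ m≤n = inj₁ ([ (λ h → a , h , ca) , (λ h → b , h , cb) ]′
          (+-<-split {a} {b} (≤-trans lt (+-monoʳ-≤ n m≤n))))
        pt₁ = Decides.orient dP₁ et.isSep et.order ≤-refl
        pt₂ = Decides.orient dP₂ et.isSep et.order ≤-refl
        qs₁ = Decides.orient dQ₁ es.isSep es.order ≤-refl
        qs₂ = Decides.orient dQ₂ es.isSep es.order ≤-refl
        case₁ : P₁ t → Q₂ (s ⁻) → Improved P₁ P₂ n ⊎ Improved Q₁ Q₂ m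
        case₁ h h′ = let _ , _ , c , c′ , lt = opposite-corners S⁺ T⁺ (p₁ h) (q₂ h′)
                    in one c (corner-flip c′) lt
        case₂ : P₂ (t ⁻) → Q₁ s → Improved P₁ P₂ n ⊎ Improved Q₁ Q₂ m
        case₂ h h′ = let _ , _ , c , c′ , lt = opposite-corners S⁻ T⁻ (p₂ h) (q₁ h′)
                    in one (corner-flip c) c′ lt
        case₃ : P₁ (t ⁻) → Q₁ (s ⁻) → Improved P₁ P₂ n ⊎ Improved Q₁ Q₂ m
        case₃ h h′ = let _ , _ , c , c′ , lt = opposite-corners S⁺ T⁻ (p₁ h) (q₁ h′)
                    in one c c′ lt
        case₄ : P₂ t → Q₂ s → Improved P₁ P₂ n ⊎ Improved Q₁ Q₂ m
        case₄ h h′ = let _ , _ , c , c′ , lt = opposite-corners S⁻ T⁺ (p₂ h) (q₂ h′)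
                    in one (corner-flip c) (corner-flip c′) lt
        result : Improved P₁ P₂ n ⊎ Improved Q₁ Q₂ m
        result with pt₁ | pt₂ | qs₁ | qs₂
        ... | inj₁ h | _ | _ | inj₂ h′ = case₁ h h′
        ... | _ | inj₂ h | inj₁ h′ | _ = case₂ h h′
        ... | inj₂ h | _ | inj₂ h′ | _ = case₃ h h′
        ... | _ | inj₁ h | _ | inj₁ h′ = case₄ h h′
        -- Outside the four cases, `t` distinguishes `P₁` from `P₂` and `s` distinguishes `Q₁` from
        -- `Q₂`.
        ... | inj₁ h | inj₂ h′ | inj₂ g | inj₁ g′ =
          let _ , _ , c , c′ , lt = opposite-corners S⁺ T⁺ (p₁ h) (p₂ h′)
              _ , _ , d , d′ , lt′ = opposite-corners S⁻ T⁺ (q₁ g) (q₂ g′)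
          in two c (corner-flip c′) lt d (corner-flip d′) lt′
        ... | inj₂ h | inj₁ h′ | inj₁ g | inj₂ g′ =
          let _ , _ , c , c′ , lt = opposite-corners S⁺ T⁻ (p₁ h) (p₂ h′)
              _ , _ , d , d′ , lt′ = opposite-corners S⁺ T⁺ (q₁ g) (q₂ g′)
          in two c (corner-flip c′) lt d (corner-flip d′) lt′

-- Existence and nestedness of the chosen separators.

module Splinter (em : ExcludedMiddle 0ℓ) (em₁ : ExcludedMiddle (lsuc 0ℓ)) (G : Graph)
  {I : Set} (Ps : I → SepPred G)
  (robustRegular : ∀ i → Uncrossing.RobustRegular em em₁ G (Ps i)) where
  open Graph G
  open Notions G
  open Choice Ps
  open Separators em G
  open Uncrossing em em₁ G

  module _ {i j k s} (e : Eff (Ps i) (Ps j) k s) where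
    decidesˡ : Decides (Ps i) k
    decidesˡ = eff-decidesˡ (robustRegular i) e
    decidesʳ : Decides (Ps j) k
    decidesʳ = eff-decidesʳ (robustRegular j) e

  ofOrder-tight : ∀ {k X} → OfOrder k X → Tight X
  ofOrder-tight (i , j , s , eq , e) = tight-cong eq (sided-tight (eff-sided (decidesˡ e) (decidesʳ e) e))

  ofOrder-size : ∀ {k X} → OfOrder k X → HasSize G X k
  ofOrder-size (i , j , s , eq , e) = hasSize-cong eq (Eff.order e)

  effSeparator-cong : ∀ {P Q k X Y} → _≐_ G X Y → EffSeparator P Q k X → EffSeparator P Q k Y
  effSeparator-cong eq (s , eq′ , e) = s , ≐-trans eq′ eq , e

  ofOrder-cong : ∀ {k X Y} → _≐_ G X Y → OfOrder k X → OfOrder k Y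
  ofOrder-cong eq (i , j , x) = i , j , effSeparator-cong eq x

  selected-ofOrder : ∀ {F k X} → Selected F k X → OfOrder k X
  selected-ofOrder (i , j , (x , _) , _) = i , j , x

  selected-cong : ∀ {F k X Y} → _≐_ G X Y → Selected F k X → Selected F k Y
  selected-cong {k = k} eq (i , j , (x , nested) , min) =
    i , j , (effSeparator-cong eq x , λ Z z → misses-⊆ (proj₂ eq) (nested Z z)) ,
    λ Z z n cn → crossingNumber-cong (OfOrder k) ofOrder-tight ofOrder-cong eq (min Z z n cn)

  chosenBelow-cong : ∀ k {X Y} → _≐_ G X Y → ChosenBelow k X → ChosenBelow k Y
  chosenBelow-cong (suc k) eq (inj₁ x) = inj₁ (chosenBelow-cong k eq x)
  chosenBelow-cong (suc k) eq (inj₂ x) = inj₂ (selected-cong eq x)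

  chosenBelow-selected : ∀ k {X} → ChosenBelow k X → ∃[ l ] (l < k × Selected (ChosenBelow l) l X)
  chosenBelow-selected (suc k) (inj₁ x) =
    let l , l<k , sel = chosenBelow-selected k x in l , m≤n⇒m≤1+n l<k , sel
  chosenBelow-selected (suc k) (inj₂ x) = k , ≤-refl , x

  selected-chosenBelow : ∀ k {l X} → l < k → Selected (ChosenBelow l) l X → ChosenBelow k X
  selected-chosenBelow (suc k) {l} (s≤s l≤k) sel with m≤n⇒m<n∨m≡n l≤k
  ... | inj₁ l<k = inj₁ (selected-chosenBelow k l<k sel)
  ... | inj₂ refl = inj₂ sel

  chosenBelow-tight : ∀ k {X} → ChosenBelow k X → Tight X
  chosenBelow-tight k x = ofOrder-tight (selected-ofOrder (proj₂ (proj₂ (chosenBelow-selected k x))))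

  crossingNumber-finite : ∀ {k X} → OfOrder k X → ∃[ n ] CrossingNumber≤ (OfOrder k) X n
  crossingNumber-finite {k} x =
    let n , cov = finitely-many-crossing (k , ofOrder-size x) k
    in n , covers-mono (λ { Z (z , cross) → (ofOrder-tight z , k , ofOrder-size z , ≤-refl) , cross })
         ≤-refl cov

  -- If `X` and `Y` crossed, some corner would distinguish the pair of one of them with a smaller
  -- crossing number. By `corner-misses` it would still be nested with everything chosen at lower
  -- orders, hence be a better candidate.
  selected-nested : ∀ {k X Y} → Selected (ChosenBelow k) k X → Selected (ChosenBelow k) k Y → X Misses Y
  selected-nested {k} {X} {Y}
    sx@(_ , _ , ((s , eqX , es) , nx) , minx) sy@(_ , _ , ((t , eqY , et) , ny) , miny) = stable absurd
    where
    TX = selected-ofOrder sx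
    TY = selected-ofOrder sy
    LeastCrossing : VSet G → Set₁
    LeastCrossing Z = ∃[ n ] (CrossingNumber≤ (OfOrder k) Z n ×
      (∀ l → CrossingNumber≤ (OfOrder k) Z l → n ≤ l))
    leastCrossing : ∀ {Z} → OfOrder k Z → LeastCrossing Z
    leastCrossing {Z} z =
      least em₁ (CrossingNumber≤ (OfOrder k) Z) _ (proj₂ (crossingNumber-finite z))
    nested : ¬ X Misses Y → ∀ {W} → _⊆_ G W (_∪_ G X Y) → ∀ Z → ChosenBelow k Z → Z Misses W
    nested cross W⊆ Z z = corner-misses (chosenBelow-tight k z) cross
      (misses-sym (ofOrder-tight TX) (nx Z z)) (misses-sym (ofOrder-tight TY) (ny Z z)) W⊆
    refute : ¬ X Misses Y → LeastCrossing X → LeastCrossing Y → ⊥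
    refute cross (n , cX , leastn) (m , cY , leastm) =
      [ (λ { (a , a<n , r , er , r⊆ , cr) → <⇒≱ a<n (leastn a
              (minx (∂ r) ((r , ((λ _ → id) , λ _ → id) , er) , nested cross r⊆) a cr)) }) ,
        (λ { (a , a<m , r , er , r⊆ , cr) → <⇒≱ a<m (leastm a
              (miny (∂ r) ((r , ((λ _ → id) , λ _ → id) , er) , nested cross r⊆) a cr)) }) ]′
      (uncross-equal (OfOrder k) ofOrder-tight ofOrder-cong TX TY cross cX cY
        (decidesˡ es) (decidesʳ es) (decidesˡ et) (decidesʳ et) es et eqX eqY)
    absurd : ¬ ¬ X Misses Y
    absurd cross = refute cross (leastCrossing TX) (leastCrossing TY)

  all-selected-nested : ∀ {k l X Y} → Selected (ChosenBelow k) k X → Selected (ChosenBelow l) l Y →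
    X Misses Y
  all-selected-nested {k} {l} sx@(_ , _ , (_ , nx) , _) sy@(_ , _ , (_ , ny) , _) with <-cmp k l
  ... | tri< k<l _ _ = ny _ (selected-chosenBelow l k<l sx)
  ... | tri≈ _ refl _ = selected-nested sx sy
  ... | tri> _ _ l<k =
    misses-sym (ofOrder-tight (selected-ofOrder sx)) (nx _ (selected-chosenBelow k l<k sy))

  chosenBelow-nested : ∀ k {X Y} → ChosenBelow k X → ChosenBelow k Y → X Misses Y
  chosenBelow-nested k x y = all-selected-nested
    (proj₂ (proj₂ (chosenBelow-selected k x))) (proj₂ (proj₂ (chosenBelow-selected k y)))

  -- Replacing X by its corner with a chosen Z that it crosses removes Z from the
  -- chosen sets crossed by X and adds none, since Z is nested with all of them.
  candidate-exists : ∀ {i j k X} → EffSeparator (Ps i) (Ps j) k X →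
    ∃[ Y ] Candidate (ChosenBelow k) i j k Y
  candidate-exists {i} {j} {k} x =
    -- The sets chosen before are tight and of size less than `k`, so only finitely many of them
    -- cross `X`; the recursion runs on a bound for their number.
    let n , cov = finitely-many-crossing (k , ofOrder-size (i , j , x)) k
    in go n x (covers-mono (λ { Z (z , cross) →
         let l , l<k , sel = chosenBelow-selected k z
         in (chosenBelow-tight k z , l , ofOrder-size (selected-ofOrder sel) , <⇒≤ l<k) , cross }) ≤-refl cov)
    where
    CrossesChosen : VSet G → VSet G → Set₁
    CrossesChosen X Z = ChosenBelow k Z × ¬ Z Misses X
    nested? : ∀ X → Dec (∃[ Z ] CrossesChosen X Z)
    nested? X = em₁
    uncross : ∀ {X Z n} → EffSeparator (Ps i) (Ps j) k X → CrossesChosen X Z →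
      Covers (_≐_ G) (CrossesChosen X) n →
      ∃[ W ] (EffSeparator (Ps i) (Ps j) k W × ∃[ m ] (m < n × Covers (_≐_ G) (CrossesChosen W) m))
    uncross {X} {Z} x@(t , eqX , et) (z , cross) cov =
      let l , l<k , (_ , _ , ((s , eqZ , es) , _) , _) = chosenBelow-selected k z
          r , er , r⊆ , s-misses-r =
            uncross-lower (decidesˡ es) (decidesʳ es) (decidesˡ et) (decidesʳ et) es et l<k
          r⊆′ = λ v → [ inj₁ ∘ proj₁ eqZ v , inj₂ ∘ proj₁ eqX v ]′ ∘ r⊆ v
      in ∂ r , (r , ((λ _ → id) , λ _ → id) , er) , covers-remove em₁ (_≐_ G) ≐-sym
           (λ { eq (z′ , c′) → chosenBelow-cong k eq z′ , c′ ∘ misses-cong (≐-sym eq) })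
           (fewer r⊆′) Z (z , cross) (λ { (_ , c′) → c′ (misses-cong eqZ s-misses-r) }) cov
      where
      fewer : ∀ {W} → _⊆_ G W (_∪_ G Z X) → ∀ Z′ → CrossesChosen W Z′ → CrossesChosen X Z′
      fewer W⊆ Z′ (z′ , cross′) = z′ , λ miss → cross′ (corner-misses (chosenBelow-tight k z′) cross
        (chosenBelow-nested k z z′) (misses-sym (ofOrder-tight (i , j , x)) miss) W⊆)
    go : ∀ n {X} → EffSeparator (Ps i) (Ps j) k X → Covers (_≐_ G) (CrossesChosen X) n →
      ∃[ Y ] Candidate (ChosenBelow k) i j k Y
    go n {X} x cov with nested? X
    ... | no none = X , x , λ Z z → stable λ cross → none (Z , z , cross)
    go zero x cov | yes (Z , c) =
      let _ , _ , _ , m<0 , _ = uncross x c cov in contradiction m<0 λ ()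
    go (suc n) x cov | yes (Z , c) =
      let W , w , m , m<n , cov′ = uncross x c cov
      in go n w (covers-mono (λ _ → id) (≤-pred m<n) cov′)

  -- Candidates have finite crossing numbers, so one attaining the least bound among all candidates
  -- for `i` and `j` can be taken.
  selected-exists : ∀ {i j k X} → EffSeparator (Ps i) (Ps j) k X →
    ∃[ Y ] (Selected (ChosenBelow k) k Y × EffSeparator (Ps i) (Ps j) k Y)
  selected-exists {i} {j} {k} x =
    let Y , y = candidate-exists x
        n , cn = crossingNumber-finite (i , j , proj₁ y)
        m , (Z , z , cz) , min = least em₁ (λ n → ∃[ Y ] (Candidate (ChosenBelow k) i j k Y ×
          CrossingNumber≤ (OfOrder k) Y n)) n (Y , y , cn)
    in Z , (i , j , z , λ Y′ y′ n′ cn′ →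
         covers-mono (λ _ → id) (min n′ (Y′ , y′ , cn′)) cz) , proj₁ z

  eff-exists : ∀ {i j} → Distinguishable G (Ps i) (Ps j) → ∃[ k ] ∃[ s ] Eff (Ps i) (Ps j) k s
  eff-exists {i} {j} (s , dist) =
    efficient (least em₁ D (proj₁ finite) (s , dist , proj₂ finite))
    where
    profile-finite : ∀ {i s} → Ps i s → ∃[ n ] HasOrder G s n
    profile-finite {i} {s} p with robustRegular i
    ... | (κ , _ , inS , _) , _ = order κ (proj₂ (inS s p))
      where
      order : ∀ κ → OrderBelow G s κ → ∃[ n ] HasOrder G s n
      order (fin l) (n , o , _) = n , o
      order ℵ₀ o = o
    finite : ∃[ n ] HasOrder G s n
    finite = [ profile-finite ∘ proj₁ , profile-finite ∘ proj₂ ]′ (proj₂ dist)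
    D : ℕ → Set₁
    D n = ∃[ s ] (Distinguishes G s (Ps i) (Ps j) × HasOrder G s n)
    efficient : ∃[ k ] (D k × (∀ l → D l → k ≤ l)) → ∃[ k ] ∃[ s ] Eff (Ps i) (Ps j) k s
    efficient (k , (t , (sep , inj₁ (p , q)) , o) , min) = k , t , record
      { isSep = sep ; inP = p ; inQ = q ; order = o ; minimal = λ t m d o → min m (t , d , o) }
    efficient (k , (t , (sep , inj₂ (p , q)) , o) , min) = k , t ⁻ , record
      { isSep = inv-sep sep ; inP = p ; inQ = q ; order = inv-order t o
      ; minimal = λ t m d o → min m (t , d , o) }

  chosen-finite : ∀ {X} → Chosen X → Finite G X
  chosen-finite (k , x) = let l , _ , sel = chosenBelow-selected k x in l , ofOrder-size (selected-ofOrder sel)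

  chosen-nested : ∀ {X Y} → Chosen X → Chosen Y → ∃[ C ] (IsComponent G Y C × _⊆_ G X (_∪_ G C Y))
  chosen-nested (k , x) (l , y) = misses-nested (all-selected-nested
    (proj₂ (proj₂ (chosenBelow-selected k x))) (proj₂ (proj₂ (chosenBelow-selected l y))))

  chosen-distinguishes : ∀ {i j} → Distinguishable G (Ps i) (Ps j) →
    ∃[ X ] (Chosen X × SetEffDistinguishes G X (Ps i) (Ps j))
  chosen-distinguishes {i} {j} dist = choose (eff-exists dist)
    where
    Goal : Set₁
    Goal = ∃[ X ] (Chosen X × SetEffDistinguishes G X (Ps i) (Ps j))
    distinguish : ∀ {k} → ∃[ X ] (Selected (ChosenBelow k) k X × EffSeparator (Ps i) (Ps j) k X) → Goal
    distinguish {k} (X , sel , (t , eq , e)) = X , (suc k , inj₂ sel) ,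
      t , eq , (isSep , inj₁ (inP , inQ)) , k , order , minimal
      where open Eff e
    choose : ∃[ k ] ∃[ s ] Eff (Ps i) (Ps j) k s → Goal
    choose (k , s , e) = distinguish (selected-exists (s , ((λ _ → id) , λ _ → id) , e))

-- Invariance under isomorphisms.

inverse : ∀ {G G′} → Iso G G′ → Iso G′ G
inverse {G} {G′} φ = record
  { f = g ; g = f ; fg = gf ; gf = fg
  ; hom = λ u v →
      (λ e → proj₂ (hom (g u) (g v)) (subst₂ (Graph.E G′) (sym (fg u)) (sym (fg v)) e)) ,
      (λ e → subst₂ (Graph.E G′) (fg u) (fg v) (proj₁ (hom (g u) (g v)) e)) }
  where open Iso φ

-- Invariance is proved for φ-related objects; each relation is symmetric under inverting φ, so
-- every statement needs only one direction.
module _ {G G′ : Graph} (φ : Iso G G′) where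
  open Iso φ
  open Graph G using (V; E)
  open Graph G′ using () renaming (V to V′; E to E′)

  Related : VSet G → VSet G′ → Set
  Related X X′ = (∀ v → X v → X′ (f v)) × (∀ v′ → X′ v′ → X (g v′))

  RelatedSep : Sep G → Sep G′ → Set
  RelatedSep s s′ = Related (proj₁ s) (proj₁ s′) × Related (proj₂ s) (proj₂ s′)

  RelatedProfile : SepPred G → SepPred G′ → Set₁
  RelatedProfile P P′ = ∀ s s′ → RelatedSep s s′ → (P s → P′ s′) × (P′ s′ → P s)

  pull-related : ∀ X′ → Related (pullV φ X′) X′
  pull-related X′ = (λ _ → id) , λ v′ → subst X′ (sym (fg v′))

  push-related : ∀ X → Related X (pushV φ X)
  push-related X = (λ v → subst X (sym (gf v))) , λ _ → id

  related-∈ : ∀ {X X′} → Related X X′ → ∀ {v′} → X (g v′) → X′ v′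
  related-∈ {X′ = X′} (to , _) {v′} x = subst X′ (fg v′) (to _ x)

  related-∈⁻ : ∀ {X X′} → Related X X′ → ∀ {v} → X′ (f v) → X v
  related-∈⁻ {X} (_ , from) {v} x = subst X (gf v) (from _ x)

  related-∩ : ∀ {X X′ Y Y′} → Related X X′ → Related Y Y′ → Related (_∩_ G X Y) (_∩_ G′ X′ Y′)
  related-∩ (to , from) (to′ , from′) =
    (λ v (x , y) → to v x , to′ v y) , λ v (x , y) → from v x , from′ v y

  reach-related : ∀ {X X′ u v} → Related X X′ → Reach G X u v → Reach G′ X′ (f u) (f v)
  reach-related rel (here ¬x) = here (¬x ∘ related-∈⁻ rel)
  reach-related rel (step r e ¬x) =
    step (reach-related rel r) (proj₁ (hom _ _) e) (¬x ∘ related-∈⁻ rel)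

  full-related : ∀ {X X′ d} → Related X X′ → Notions.Full⟨_⟩ G X d → Notions.Full⟨_⟩ G′ X′ (f d)
  full-related rel (¬x , nb) = ¬x ∘ related-∈⁻ rel , λ x′ x∈ →
    let v , r , e = nb (g x′) (proj₂ rel x′ x∈)
    in f v , reach-related rel r , subst (E′ (f v)) (fg x′) (proj₁ (hom _ _) e)

  isSep-related : ∀ {s s′} → RelatedSep s s′ → IsSeparation G s → IsSeparation G′ s′
  isSep-related (relA , relB) (cover , noEdge) =
    (λ v′ → [ inj₁ ∘ related-∈ relA , inj₂ ∘ related-∈ relB ]′ (cover (g v′))) ,
    λ u v a ¬b b ¬a e → noEdge (g u) (g v) (proj₂ relA u a) (¬b ∘ related-∈ relB)
      (proj₂ relB v b) (¬a ∘ related-∈ relA) (proj₁ (Iso.hom (inverse φ) u v) e)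

  hasSize-related : ∀ {X X′ n} → Related X X′ → HasSize G X n → HasSize G′ X′ n
  hasSize-related {X} {X′} rel (xs , len , uniq , mem) =
    map f xs , trans (length-map f xs) len , Uniqueₚ.map⁺ injective uniq , λ v′ → to v′ , from v′
    where
    injective : ∀ {u v} → f u ≡ f v → u ≡ v
    injective {u} {v} eq = trans (sym (gf u)) (trans (cong g eq) (gf v))
    to : ∀ v′ → X′ v′ → v′ ∈ map f xs
    to v′ x = subst (_∈ map f xs) (fg v′) (∈-map⁺ f (proj₁ (mem (g v′)) (proj₂ rel v′ x)))
    from : ∀ v′ → v′ ∈ map f xs → X′ v′
    from v′ v∈ with ∈-map⁻ f v∈
    ... | v , v∈xs , refl = proj₁ rel v (proj₂ (mem v) v∈xs)

relatedSep-inverse : ∀ {G G′} (φ : Iso G G′) {s s′} →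
  RelatedSep φ s s′ → RelatedSep (inverse φ) s′ s
relatedSep-inverse φ (a , b) = swap a , swap b

relatedProfile-inverse : ∀ {G G′} (φ : Iso G G′) {P P′} →
  RelatedProfile φ P P′ → RelatedProfile (inverse φ) P′ P
relatedProfile-inverse φ rel s′ s (a , b) = swap (rel s s′ (swap a , swap b))

module _ {G G′ : Graph} (φ : Iso G G′) where
  open Iso φ
  open Notions

  misses-related : ∀ {X X′ Y Y′} → Related φ X X′ → Related φ Y Y′ →
    _Misses_ G X Y → _Misses_ G′ X′ Y′
  misses-related {X} {X′} relX relY (d , full , miss) =
    f d , full-related φ relX full , λ v′ r y → miss (g v′)
      (subst (λ u → Reach G X u (g v′)) (gf d) (reach-related (inverse φ) (swap relX) r))
      (proj₂ relY v′ y)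

  distinguishes-related : ∀ {P P′ Q Q′ s s′} → RelatedProfile φ P P′ → RelatedProfile φ Q Q′ →
    RelatedSep φ s s′ → Distinguishes G s P Q → Distinguishes G′ s′ P′ Q′
  distinguishes-related relP relQ rel@(a , b) (sep , dist) = isSep-related φ rel sep ,
    [ (λ (p , q) → inj₁ (proj₁ (relP _ _ rel) p , proj₁ (relQ _ _ (b , a)) q)) ,
      (λ (p , q) → inj₂ (proj₁ (relP _ _ (b , a)) p , proj₁ (relQ _ _ rel) q)) ]′ dist

module _ {G G′ : Graph} (φ : Iso G G′) where
  open Iso φ
  open Notions

  effSeparator-related : ∀ {P P′ Q Q′ k X X′} → RelatedProfile φ P P′ → RelatedProfile φ Q Q′ →
    Related φ X X′ → EffSeparator G P Q k X → EffSeparator G′ P′ Q′ k X′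
  effSeparator-related relP relQ relX ((A , B) , (∂⊆X , X⊆∂) , e) =
    (pushV φ A , pushV φ B) ,
    ((λ v′ → related-∈ φ relX ∘ ∂⊆X (g v′)) , λ v′ → X⊆∂ (g v′) ∘ proj₂ relX v′) ,
    record
      { isSep = isSep-related φ rel isSep
      ; inP = proj₁ (relP _ _ rel) inP
      ; inQ = proj₁ (relQ _ _ (swap rel)) inQ
      ; order = hasSize-related φ (related-∩ φ (proj₁ rel) (proj₂ rel)) order
      -- A distinguisher in `G′` pulls back to one of the same order in `G`, where minimality is
      -- known.
      ; minimal = λ { (C , D) m dist o → minimal (pullV φ C , pullV φ D) m
          (distinguishes-related (inverse φ) (relatedProfile-inverse φ relP)
            (relatedProfile-inverse φ relQ)
            (relatedSep-inverse φ (pull-related φ C , pull-related φ D)) dist)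
          (hasSize-related (inverse φ)
            (swap (related-∩ φ (pull-related φ C) (pull-related φ D))) o) } }
    where
    open Eff e
    rel : RelatedSep φ (A , B) (pushV φ A , pushV φ B)
    rel = push-related φ A , push-related φ B

  -- The cover is pushed forward, and a member of `T′` is found in it by pulling that member back;
  -- hence the direction of the hypothesis on `T` and `T′`.
  crossingNumber-related : ∀ {T T′ X X′ n} → (∀ Z′ → T′ Z′ → T (pullV φ Z′)) → Related φ X X′ →
    CrossingNumber≤ G T X n → CrossingNumber≤ G′ T′ X′ n
  crossingNumber-related TT relX (L , len , cov) =
    map (pushV φ) L , ≤-trans (≤-reflexive (length-map (pushV φ) L)) len ,
    λ Z′ (z′ , cross) → Anyₚ.map⁺ (Any.map
      (λ (to , from) → (λ v′ → to (g v′) ∘ proj₂ (pull-related φ Z′) v′) ,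
                       λ v′ → related-∈ φ (pull-related φ Z′) ∘ from (g v′))
      (cov (pullV φ Z′) (TT Z′ z′ , cross ∘ misses-related φ (pull-related φ Z′) relX)))

  module _ {I J : Set} (Ps : I → SepPred G) (Qs : J → SepPred G′) where

    RelatedFamily : Set₁
    RelatedFamily = (∀ i → ∃[ j ] RelatedProfile φ (Ps i) (Qs j)) ×
                    (∀ j → ∃[ i ] RelatedProfile φ (Ps i) (Qs j))

    candidate-related : ∀ {F F′ i j i′ j′ k X X′} → (∀ Z′ → F′ Z′ → F (pullV φ Z′)) →
      RelatedProfile φ (Ps i) (Qs i′) → RelatedProfile φ (Ps j) (Qs j′) → Related φ X X′ →
      Choice.Candidate G Ps F i j k X → Choice.Candidate G′ Qs F′ i′ j′ k X′
    candidate-related FF relᵢ relⱼ relX (x , nested) = effSeparator-related relᵢ relⱼ relX x ,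
      λ Z′ z′ → misses-related φ (pull-related φ Z′) relX (nested (pullV φ Z′) (FF Z′ z′))

    ofOrder-related : RelatedFamily → ∀ {k X X′} → Related φ X X′ →
      Choice.OfOrder G Ps k X → Choice.OfOrder G′ Qs k X′
    ofOrder-related (to , _) relX (i , j , x) =
      let i′ , relᵢ = to i ; j′ , relⱼ = to j in i′ , j′ , effSeparator-related relᵢ relⱼ relX x

module _ {G G′ : Graph} (φ : Iso G G′) {I J : Set} (Ps : I → SepPred G) (Qs : J → SepPred G′) where
  open Notions

  relatedFamily-inverse : RelatedFamily φ Ps Qs → RelatedFamily (inverse φ) Qs Ps
  relatedFamily-inverse (to , from) =
    (λ j → let i , rel = from j in i , relatedProfile-inverse φ rel) ,
    (λ i → let j , rel = to i in j , relatedProfile-inverse φ rel)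

  selected-related : RelatedFamily φ Ps Qs → ∀ {F F′ k X X′} →
    (∀ Z → F Z → F′ (pushV φ Z)) → (∀ Z′ → F′ Z′ → F (pullV φ Z′)) → Related φ X X′ →
    Choice.Selected G Ps F k X → Choice.Selected G′ Qs F′ k X′
  selected-related fam FF′ F′F relX (i , j , cand , min) =
    let i′ , relᵢ = proj₁ fam i ; j′ , relⱼ = proj₁ fam j in
    i′ , j′ , candidate-related φ Ps Qs F′F relᵢ relⱼ relX cand , λ Y′ cand′ n cn →
      crossingNumber-related φ
        (λ Z′ → ofOrder-related (inverse φ) Qs Ps (relatedFamily-inverse fam) (swap (pull-related φ Z′)))
        relX
        -- A competitor in `G′` and the bound on its crossing number are pulled back, compared with
        -- `X` in `G`, and the resulting bound is pushed forward.
        (min (pullV φ Y′)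
          (candidate-related (inverse φ) Qs Ps FF′ (relatedProfile-inverse φ relᵢ)
            (relatedProfile-inverse φ relⱼ) (swap (pull-related φ Y′)) cand′) n
          (crossingNumber-related (inverse φ)
            (λ Z → ofOrder-related φ Ps Qs fam (push-related φ Z))
            (swap (pull-related φ Y′)) cn))

-- Selection at order `k` needs the correspondence of the earlier choices in both directions; the
-- recursion obtains the backward one by calling itself at `inverse φ`.
chosenBelow-related : ∀ {G G′} (φ : Iso G G′) {I J : Set} (Ps : I → SepPred G) (Qs : J → SepPred G′) →
  RelatedFamily φ Ps Qs → ∀ k {X X′} → Related φ X X′ →
  Notions.Choice.ChosenBelow G Ps k X → Notions.Choice.ChosenBelow G′ Qs k X′
chosenBelow-related φ Ps Qs fam (suc k) rel (inj₁ x) = inj₁ (chosenBelow-related φ Ps Qs fam k rel x)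
chosenBelow-related φ Ps Qs fam (suc k) rel (inj₂ x) = inj₂ (selected-related φ Ps Qs fam
  (λ Z → chosenBelow-related φ Ps Qs fam k (push-related φ Z))
  (λ Z′ → chosenBelow-related (inverse φ) Qs Ps (relatedFamily-inverse φ Ps Qs fam) k
    (swap (pull-related φ Z′))) rel x)

profEq-related : ∀ {G G′} (φ : Iso G G′) {P Q} → Respects G P → ProfEq G′ (pushProfile φ P) Q →
  RelatedProfile φ P Q
profEq-related {G} φ resp eq (A , B) (A′ , B′) (relA , relB) =
  proj₁ (eq (A′ , B′)) ∘ resp _ _ (same relA , same relB) ,
  resp _ _ (swap (same relA) , swap (same relB)) ∘ proj₂ (eq (A′ , B′))
  where
  same : ∀ {X X′} → Related φ X X′ → _≐_ G X (pullV φ X′)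
  same rel = proj₁ rel , λ v → related-∈⁻ φ rel

theorem1p3 : ExcludedMiddle 0ℓ → ExcludedMiddle (lsuc 0ℓ) → ExcludedMiddle (lsuc (lsuc 0ℓ)) →
    Σ ((G : Graph) → (I : Set) → (I → SepPred G) → VFam G) λ N →
    (∀ (G : Graph) (I : Set) (Ps : I → SepPred G) → GoodProfileSet G I Ps →
    (∀ X → N G I Ps X → Finite G X) ×
    Nested G (N G I Ps) ×
    (∀ i j → i ≢ j → ∃[ X ] (N G I Ps X × SetEffDistinguishes G X (Ps i) (Ps j))))
    ×
    (∀ (G G' : Graph) (φ : Iso G G') (I : Set) (Ps : I → SepPred G) (J : Set) (Qs : J → SepPred G') →
    GoodProfileSet G I Ps → GoodProfileSet G' J Qs →
    SameProfileSets G' I (λ i → pushProfile φ (Ps i)) J Qs →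
    IsImageFam φ (N G I Ps) (N G' J Qs))
theorem1p3 em em₁ _ = N , distinguishing , canonical
  where
  -- The decision by em₁ serves to lower the universe level of Chosen to that required by VFam.
  N : (G : Graph) → (I : Set) → (I → SepPred G) → VFam G
  N G I Ps X = True (em₁ {Notions.Choice.Chosen G Ps X})
  distinguishing : ∀ G I Ps → GoodProfileSet G I Ps →
    (∀ X → N G I Ps X → Finite G X) × Nested G (N G I Ps) ×
    (∀ i j → i ≢ j → ∃[ X ] (N G I Ps X × SetEffDistinguishes G X (Ps i) (Ps j)))
  distinguishing G I Ps (rr , dist) =
    (λ X x → chosen-finite (toWitness x)) ,
    (λ X Y x y → chosen-nested (toWitness x) (toWitness y)) ,
    λ i j i≢j → let X , x , eff = chosen-distinguishes (dist i j i≢j) in X , fromWitness x , eff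
    where open Splinter em em₁ G Ps rr
  canonical : ∀ G G′ (φ : Iso G G′) I Ps J Qs → GoodProfileSet G I Ps → GoodProfileSet G′ J Qs →
    SameProfileSets G′ I (λ i → pushProfile φ (Ps i)) J Qs → IsImageFam φ (N G I Ps) (N G′ J Qs)
  canonical G G′ φ I Ps J Qs (rr , _) _ (to , from) =
    (λ X x → let k , c = toWitness x in
      pushV φ X , fromWitness (k , chosenBelow-related φ Ps Qs fam k (push-related φ X) c) ,
      (λ _ → id) , λ _ → id) ,
    (λ Y y → let k , c = toWitness y in
      pullV φ Y ,
      fromWitness (k , chosenBelow-related (inverse φ) Qs Ps (relatedFamily-inverse φ Ps Qs fam) k
        (swap (pull-related φ Y)) c) ,
      proj₂ (pull-related φ Y) , λ v → related-∈ φ (pull-related φ Y))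
    where
    fam : RelatedFamily φ Ps Qs
    fam = (λ i → let j , eq = to i in j , related i eq) , λ j → let i , eq = from j in i , related i eq
      where
      related : ∀ i {Q} → ProfEq G′ (pushProfile φ (Ps i)) Q → RelatedProfile φ (Ps i) Q
      related i = profEq-related φ (proj₁ (proj₂ (proj₁ (rr i))))
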